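{- For a nonnegative integer $n$, let $Q_5(n)$ be the number of partitions of $n$ into distinct parts congruent to $\pm 1,\pm 5,\pm 7,\pm 9 \pmod{24}$; let $Q_{11}(n)$ be the number of partitions of $n$ into distinct parts congruent to $\pm 1,\pm 7,\pm 9,\pm 11 \pmod{24}$; let $\mathfrak{Q}_7(n)$ be the number of partitions of $n$ into distinct parts congruent to $\pm 1,\pm 7,\pm 9,\pm 11 \pmod{30}$; and let $\mathfrak{Q}_{13}(n)$ be the number of partitions of $n$ into distinct parts congruent to $\pm 1,\pm 9,\pm 11,\pm 13 \pmod{30}$. Then $Q_5(n-1)=Q_{11}(n)$ and $\mathfrak{Q}_7(n-1)=\mathfrak{Q}_{13}(n)$ for all positive integers $n\equiv 4 \pmod 6$. Moreover, there are infinitely many positive integers $n\equiv 0$ or $2 \pmod 6$ with $Q_5(n-1)\neq Q_{11}(n)$, and infinitely many positive integers $m\equiv 0$ or $2\pmod 6$ with $\mathfrak{Q}_7(m-1)\neq \mathfrak{Q}_{13}(m)$.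
   Context: A partition of $n$ is a non-increasing sequence of positive integers summing to $n$; the empty partition is the unique partition of $0$. -}

module Defs where

open import Data.Nat using (ℕ; zero; suc; _∸_; _≤?_; _≟_; _%_)
open import Data.List using (List; []; _∷_; _++_; map; filterᵇ; length)
open import Data.Bool.ListAction using (any; all)
open import Data.Bool using (Bool)
open import Relation.Nullary using (yes; no)
open import Relation.Nullary.Decidable using (⌊_⌋)

-- A partition into distinct parts is a strictly decreasing list of positive
-- integers (largest part first).

strictDecr : ℕ → ℕ → List (List ℕ)
strictDecr zero zero = [] ∷ []
strictDecr zero (suc n) = []
strictDecr (suc k) n with suc k ≤? n
... | yes _ = strictDecr k n ++ map (suc k ∷_) (strictDecr k (n ∸ suc k))
... | no _ = strictDecr k n

-- All partitions of n into distinct parts (every part is ≤ n).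
distinctPartitions : ℕ → List (List ℕ)
distinctPartitions n = strictDecr n n

countDistinct : (ℕ → Bool) → ℕ → ℕ
countDistinct p n = length (filterᵇ (all p) (distinctPartitions n))

res24 : List ℕ → ℕ → Bool
res24 rs k = any (λ r → ⌊ k % 24 ≟ r ⌋) rs

res30 : List ℕ → ℕ → Bool
res30 rs k = any (λ r → ⌊ k % 30 ≟ r ⌋) rs

Q5 : ℕ → ℕ
Q5 = countDistinct (res24 (1 ∷ 23 ∷ 5 ∷ 19 ∷ 7 ∷ 17 ∷ 9 ∷ 15 ∷ []))

Q11 : ℕ → ℕ
Q11 = countDistinct (res24 (1 ∷ 23 ∷ 7 ∷ 17 ∷ 9 ∷ 15 ∷ 11 ∷ 13 ∷ []))

𝔔7 : ℕ → ℕ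
𝔔7 = countDistinct (res30 (1 ∷ 29 ∷ 7 ∷ 23 ∷ 9 ∷ 21 ∷ 11 ∷ 19 ∷ []))

𝔔13 : ℕ → ℕ
𝔔13 = countDistinct (res30 (1 ∷ 29 ∷ 9 ∷ 21 ∷ 11 ∷ 19 ∷ 13 ∷ 17 ∷ []))

{-# OPTIONS --safe #-}

-- Put M = 4 (modulus 24) or M = 5 (modulus 30), and let G and F be the generating functions of the
-- partitions into distinct parts ≡ ±1, ±(2M-1), ±(2M+1), ±(2M+3), respectively ±1, ±(2M-3), ±(2M-1),
-- ±(2M+1), modulo 6M.  Write f(x,y) = Σ x^(k(k+1)/2) y^(k(k-1)/2) over k ∈ ℤ.  The triple product
-- identity turns G and q F into the common factor f(q^(2M-1), q) / (q^(2M); q^(2M)) times theta functions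
-- over (q^(6M); q^(6M)), and rotating the lattice of the quadratic form 3X² + Y² gives
--   f(q^(2M-1), q) (f(q^(2M+3), q^(4M-3)) - q f(q^(4M+3), q^(2M-3))) = f(-q^(2M-2), -q²) f(-q^(4M), -q^(2M)),
-- whose last factor is (q^(2M); q^(2M)).  Hence
--   (G - q F) (q^(6M); q^(6M)) = f(-q^(2M-2), -q²).
-- The exponents on the right are ≡ 0 or 2 (mod 6), and so are those of G - q F.  If G - q F vanished on a
-- long interval, its product with the pentagonal series of (q^(6M); q^(6M)) would have the coefficient ±1
-- at a large pentagonal exponent, at which the right-hand side has none.
-- The identities hold in every commutative ring with q^N = 0, where the sums and products are finite.
module Submission where

open import Defs
open import Algebra.Bundles using (CommutativeRing)
import Algebra.Properties.CommutativeSemiring.Exp as Exp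
import Algebra.Solver.Ring.NaturalCoefficients.Default as SemiringSolver
open import Algebra.Structures using (IsCommutativeRing)
open import Data.Bool as Bool using (Bool; true; false; if_then_else_)
open import Data.Bool.ListAction using (any; all)
open import Data.Integer as ℤ using (ℤ; +_; -[1+_]; ∣_∣)
import Data.Integer.Properties as ℤₚ
import Data.Integer.Solver
open import Data.Integer.Tactic.RingSolver using (solve-∀)
open import Data.List using (List; []; _∷_; map; filterᵇ; length)
open import Data.List.Properties using (length-++; filter-++)
open import Data.Nat as ℕ using (ℕ; zero; suc; _%_; _≤_; _∸_)
open import Data.Nat.DivMod using ([m+kn]%n≡m%n)
import Data.Nat.Properties as ℕₚ
import Data.Nat.Tactic.RingSolver as ℕSolver
open import Data.Product using (_×_; _,_; ∃-syntax)
open import Data.Sum as Sum using (_⊎_; inj₁; inj₂)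
open import Level using (0ℓ)
open import Relation.Binary.Definitions using (tri<; tri≈; tri>)
open import Relation.Binary.PropositionalEquality as ≡ using (_≡_; _≢_)
open import Relation.Nullary using (Dec; yes; no; ¬_; contradiction; ¬?; _×-dec_; decidable-stable)
open import Relation.Nullary.Decidable using (⌊_⌋)

-- The identity between the five theta functions is the quintuple product identity f(B³Q, Q⁵/B³) -
-- B² f(Q/B³, B³Q⁵) = f(-B², -Q²/B²) (Q²; Q²) / f(BQ, Q/B) at Q = q^M and B = q^(M-1). Its second
-- term is rewritten with f(x, y) = x f(1/x, x²y), which removes the negative exponents. Division is
-- done without inverting a series: modulo q^N the Gaussian coefficient [2N, N], which already
-- occurs in the finite triple product, is the inverse of Euler's product. In base q^(6M) it is a
-- polynomial in q^(6M), so multiplication by it preserves exponents modulo 6. The price of finite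
-- sums is that every change of index needs a bound on the support; this is the origin of the radii
-- N and 2N. An exponent e of f(-q^(2M-2), -q²) satisfies 4Me + (M-2)² = (2Mk + M - 2)², and one of
-- the pentagonal series of (q^(6M); q^(6M)) satisfies 4Me + M² = (6Mj + M)². A common exponent
-- would give two squares at distance 4M - 4, too small a distance for squares of that size when j
-- is positive.

module ℤSolver = Data.Integer.Solver.+-*-Solver

-- Finite sums over ℕ, ℤ and antidiagonals

-- The reflection k ↦ -1 - k, which maps [-n, n) to itself; negation does not.
flip-ℤ : ℤ → ℤ
flip-ℤ (+ n) = -[1+ n ]
flip-ℤ -[1+ n ] = + n

suc-neg : ∀ n → ℤ.suc -[1+ n ] ≡ ℤ.- (+ n)
suc-neg zero = ≡.refl
suc-neg (suc n) = ≡.refl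

flip-ℤ≡ : ∀ k → flip-ℤ k ≡ ℤ.- k ℤ.- ℤ.1ℤ
flip-ℤ≡ (+ zero) = ≡.refl
flip-ℤ≡ (+ suc n) = ≡.cong (λ m → -[1+ suc m ]) (≡.sym (ℕₚ.+-identityʳ n))
flip-ℤ≡ -[1+ n ] = ≡.refl

module Sums {c ℓ} (R : CommutativeRing c ℓ) where

  open CommutativeRing R
  open import Relation.Binary.Reasoning.Setoid setoid
  open SemiringSolver commutativeSemiring using (solve; _:=_; _:+_; _:*_)

  sum : ℕ → (ℕ → Carrier) → Carrier
  sum zero f = 0#
  sum (suc n) f = sum n f + f n

  prod : ℕ → (ℕ → Carrier) → Carrier
  prod zero f = 1#
  prod (suc n) f = prod n f * f n

  diag : ℕ → (ℕ → ℕ → Carrier) → Carrier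
  diag zero g = g 0 0
  diag (suc n) g = g 0 (suc n) + diag n (λ a b → g (suc a) b)

  -- The sum of f over the interval [-n, n) of ℤ.
  sumℤ : ℕ → (ℤ → Carrier) → Carrier
  sumℤ n f = sum n (λ i → f (+ i) + f -[1+ i ])

  sum-cong : ∀ n {f g} → (∀ i → f i ≈ g i) → sum n f ≈ sum n g
  sum-cong zero f≈g = refl
  sum-cong (suc n) f≈g = +-cong (sum-cong n f≈g) (f≈g n)

  sum-+ : ∀ n f g → sum n (λ i → f i + g i) ≈ sum n f + sum n g
  sum-+ zero f g = sym (+-identityˡ 0#)
  sum-+ (suc n) f g = trans (+-congʳ (sum-+ n f g))
    (solve 4 (λ a b x y → (a :+ b) :+ (x :+ y) := (a :+ x) :+ (b :+ y)) refl _ _ _ _)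

  sum-*ˡ : ∀ n x f → x * sum n f ≈ sum n (λ i → x * f i)
  sum-*ˡ zero x f = zeroʳ x
  sum-*ˡ (suc n) x f = trans (distribˡ x _ _) (+-congʳ (sum-*ˡ n x f))

  sum-0 : ∀ n → sum n (λ _ → 0#) ≈ 0#
  sum-0 zero = refl
  sum-0 (suc n) = trans (+-identityʳ _) (sum-0 n)

  sum-single : ∀ n j f → j ℕ.< n → (∀ i → i ≢ j → f i ≈ 0#) → sum n f ≈ f j
  sum-single (suc n) j f j<1+n others with ℕₚ.m<1+n⇒m<n∨m≡n j<1+n
  ... | inj₁ j<n = trans (+-cong (sum-single n j f j<n others) (others n (λ n≡j → ℕₚ.<⇒≢ j<n (≡.sym n≡j)))) (+-identityʳ _)
  ... | inj₂ ≡.refl = trans (+-congʳ (initial n ℕₚ.≤-refl)) (+-identityˡ _)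
    where
    initial : ∀ m → m ℕ.≤ n → sum m f ≈ 0#
    initial zero _ = refl
    initial (suc m) m<n = trans (+-cong (initial m (ℕₚ.<⇒≤ m<n)) (others m (ℕₚ.<⇒≢ m<n))) (+-identityˡ 0#)

  sum-swap : ∀ m n (f : ℕ → ℕ → Carrier) →
    sum m (λ i → sum n (f i)) ≈ sum n (λ j → sum m (λ i → f i j))
  sum-swap zero n f = sym (sum-0 n)
  sum-swap (suc m) n f = trans (+-congʳ (sum-swap m n f)) (sym (sum-+ n _ (f m)))

  prod-cong : ∀ n {f g} → (∀ i → f i ≈ g i) → prod n f ≈ prod n g
  prod-cong zero f≈g = refl
  prod-cong (suc n) f≈g = *-cong (prod-cong n f≈g) (f≈g n)

  prod-* : ∀ n f g → prod n (λ i → f i * g i) ≈ prod n f * prod n g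
  prod-* zero f g = sym (*-identityˡ 1#)
  prod-* (suc n) f g = trans (*-congʳ (prod-* n f g))
    (solve 4 (λ a b x y → (a :* b) :* (x :* y) := (a :* x) :* (b :* y)) refl _ _ _ _)

  prod-++ : ∀ m n f → prod (n ℕ.+ m) f ≈ prod m f * prod n (λ i → f (i ℕ.+ m))
  prod-++ m zero f = sym (*-identityʳ _)
  prod-++ m (suc n) f = trans (*-congʳ (prod-++ m n f)) (*-assoc _ _ _)

  prod-1 : ∀ n f → (∀ i → f i ≈ 1#) → prod n f ≈ 1#
  prod-1 zero f f≈1 = refl
  prod-1 (suc n) f f≈1 = trans (*-cong (prod-1 n f f≈1) (f≈1 n)) (*-identityˡ 1#)

  prod-blocks : ∀ m n f → prod (n ℕ.* m) f ≈ prod n (λ i → prod m (λ j → f (j ℕ.+ i ℕ.* m)))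
  prod-blocks m zero f = refl
  prod-blocks m (suc n) f = trans (prod-++ (n ℕ.* m) m f) (*-congʳ (prod-blocks m n f))

  diag-cong : ∀ n {f g} → (∀ a b → a ℕ.+ b ≡ n → f a b ≈ g a b) → diag n f ≈ diag n g
  diag-cong zero f≈g = f≈g 0 0 ≡.refl
  diag-cong (suc n) f≈g = +-cong (f≈g 0 (suc n) ≡.refl)
    (diag-cong n (λ a b eq → f≈g (suc a) b (≡.cong suc eq)))

  diag-+ : ∀ n f g → diag n (λ a b → f a b + g a b) ≈ diag n f + diag n g
  diag-+ zero f g = refl
  diag-+ (suc n) f g = trans (+-congˡ (diag-+ n _ _))
    (solve 4 (λ a b x y → (a :+ b) :+ (x :+ y) := (a :+ x) :+ (b :+ y)) refl _ _ _ _)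

  diag-*ˡ : ∀ n x f → x * diag n f ≈ diag n (λ a b → x * f a b)
  diag-*ˡ zero x f = refl
  diag-*ˡ (suc n) x f = trans (distribˡ x _ _) (+-congˡ (diag-*ˡ n x _))

  diag-last : ∀ n f → diag (suc n) f ≈ diag n (λ a b → f a (suc b)) + f (suc n) 0
  diag-last zero f = refl
  diag-last (suc n) f = trans (+-congˡ (diag-last n (λ a b → f (suc a) b))) (sym (+-assoc _ _ _))

  diag-flip : ∀ n f → diag n f ≈ diag n (λ a b → f b a)
  diag-flip zero f = refl
  diag-flip (suc n) f = begin
    diag (suc n) f                                 ≈⟨ diag-last n f ⟩
    diag n (λ a b → f a (suc b)) + f (suc n) 0     ≈⟨ +-comm _ _ ⟩
    f (suc n) 0 + diag n (λ a b → f a (suc b))     ≈⟨ +-congˡ (diag-flip n _) ⟩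
    f (suc n) 0 + diag n (λ a b → f b (suc a))     ∎

  -- Both sides run over all triples with sum n; this becomes associativity of the Cauchy product.
  diag-assoc : ∀ n (f : ℕ → ℕ → ℕ → Carrier) →
    diag n (λ a b → diag a (λ i j → f i j b)) ≈ diag n (λ i a → diag a (f i))
  diag-assoc zero f = refl
  diag-assoc (suc n) f = begin
    f 0 0 (suc n) + diag n (λ a b → f 0 (suc a) b + diag a (λ i j → f (suc i) j b))
      ≈⟨ +-congˡ (diag-+ n _ _) ⟩
    f 0 0 (suc n) + (diag n (λ a b → f 0 (suc a) b) + diag n (λ a b → diag a (λ i j → f (suc i) j b)))
      ≈⟨ +-assoc _ _ _ ⟨
    diag (suc n) (f 0) + diag n (λ a b → diag a (λ i j → f (suc i) j b))
      ≈⟨ +-congˡ (diag-assoc n (λ i → f (suc i))) ⟩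
    diag (suc n) (f 0) + diag n (λ i a → diag a (f (suc i)))
      ∎

  private
    fromLeft fromRight : (ℕ → ℕ → Carrier) → ℕ → ℕ → Carrier
    fromLeft f zero b = 0#
    fromLeft f (suc a) b = f a b
    fromRight f a zero = 0#
    fromRight f a (suc b) = f a b

  -- The shape of a Pascal recurrence: the point (a, b) of antidiagonal n + 1 is reached from (a, b
  -- - 1) through `g` and from (a - 1, b) through `h`, and each end point has a single predecessor.
  diag-pascal : ∀ n f g h → (∀ b → f 0 (suc b) ≈ g 0 b) → (∀ a → f (suc a) 0 ≈ h a 0) →
    (∀ a b → f (suc a) (suc b) ≈ g (suc a) b + h a (suc b)) →
    diag (suc n) f ≈ diag n g + diag n h
  diag-pascal n f g h left right inner = begin
    diag (suc n) f
      ≈⟨ diag-cong (suc n) split ⟩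
    diag (suc n) (λ a b → fromRight g a b + fromLeft h a b)
      ≈⟨ diag-+ (suc n) (fromRight g) (fromLeft h) ⟩
    diag (suc n) (fromRight g) + (0# + diag n h)
      ≈⟨ +-cong (trans (diag-last n (fromRight g)) (+-identityʳ _)) (+-identityˡ _) ⟩
    diag n g + diag n h
      ∎
    where
    split : ∀ a b → a ℕ.+ b ≡ suc n → f a b ≈ fromRight g a b + fromLeft h a b
    split zero (suc b) eq = trans (left b) (sym (+-identityʳ _))
    split (suc a) zero eq = trans (right a) (sym (+-identityˡ _))
    split (suc a) (suc b) eq = inner a b

  sumℤ-cong : ∀ n {f g} → (∀ k → f k ≈ g k) → sumℤ n f ≈ sumℤ n g
  sumℤ-cong n f≈g = sum-cong n (λ i → +-cong (f≈g _) (f≈g _))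

  sumℤ-+ : ∀ n f g → sumℤ n (λ k → f k + g k) ≈ sumℤ n f + sumℤ n g
  sumℤ-+ n f g = trans
    (sum-cong n (λ i → solve 4 (λ a b x y → (a :+ b) :+ (x :+ y) := (a :+ x) :+ (b :+ y)) refl _ _ _ _))
    (sum-+ n _ _)

  sumℤ-*ˡ : ∀ n x f → x * sumℤ n f ≈ sumℤ n (λ k → x * f k)
  sumℤ-*ˡ n x f = trans (sum-*ˡ n x _) (sum-cong n (λ i → distribˡ x _ _))

  sumℤ-*ʳ : ∀ n x f → sumℤ n f * x ≈ sumℤ n (λ k → f k * x)
  sumℤ-*ʳ n x f = trans (*-comm _ x) (trans (sumℤ-*ˡ n x f) (sumℤ-cong n (λ k → *-comm x (f k))))

  sumℤ-0 : ∀ n f → (∀ k → f k ≈ 0#) → sumℤ n f ≈ 0#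
  sumℤ-0 n f f≈0 = trans (sum-cong n (λ i → trans (+-cong (f≈0 _) (f≈0 _)) (+-identityˡ 0#))) (sum-0 n)

  sumℤ-swap : ∀ m n (f : ℤ → ℤ → Carrier) →
    sumℤ m (λ i → sumℤ n (f i)) ≈ sumℤ n (λ j → sumℤ m (λ i → f i j))
  sumℤ-swap m n f = begin
    sum m (λ i → sumℤ n (f (+ i)) + sumℤ n (f -[1+ i ]))
      ≈⟨ sum-cong m (λ i → sym (sumℤ-+ n (f (+ i)) (f -[1+ i ]))) ⟩
    sum m (λ i → sumℤ n (λ j → f (+ i) j + f -[1+ i ] j))
      ≈⟨ sum-swap m n _ ⟩
    sum n (λ j → sum m (λ i → (f (+ i) (+ j) + f -[1+ i ] (+ j)) + (f (+ i) -[1+ j ] + f -[1+ i ] -[1+ j ])))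
      ≈⟨ sum-cong n (λ j → sum-+ m _ _) ⟩
    sumℤ n (λ j → sumℤ m (λ i → f i j))
      ∎

  sumℤ-flip : ∀ n f → sumℤ n (λ k → f (flip-ℤ k)) ≈ sumℤ n f
  sumℤ-flip n f = sum-cong n (λ i → +-comm _ _)

  SupportedIn : ℕ → (ℤ → Carrier) → Set ℓ
  SupportedIn n f = ∀ k → n ℕ.≤ ∣ k ∣ → f k ≈ 0#

  sumℤ-extend : ∀ m n f → SupportedIn n f → sumℤ (m ℕ.+ n) f ≈ sumℤ n f
  sumℤ-extend zero n f supp = refl
  sumℤ-extend (suc m) n f supp = begin
    sumℤ (m ℕ.+ n) f + (f (+ (m ℕ.+ n)) + f -[1+ m ℕ.+ n ])
      ≈⟨ +-cong (sumℤ-extend m n f supp)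
           (trans (+-cong (supp _ (ℕₚ.m≤n+m n m)) (supp _ (ℕₚ.m≤n⇒m≤1+n (ℕₚ.m≤n+m n m)))) (+-identityˡ 0#)) ⟩
    sumℤ n f + 0#
      ≈⟨ +-identityʳ _ ⟩
    sumℤ n f
      ∎

  sumℤ-suc : ∀ n f → sumℤ n (λ k → f (ℤ.suc k)) + f (ℤ.- (+ n)) ≈ sumℤ n f + f (+ n)
  sumℤ-suc zero f = refl
  sumℤ-suc (suc n) f = begin
    (S′ + (f (+ suc n) + f (ℤ.suc -[1+ n ]))) + f -[1+ n ]
      ≈⟨ +-congʳ (+-congˡ (+-congˡ (reflexive (≡.cong f (suc-neg n))))) ⟩
    (S′ + (f (+ suc n) + f (ℤ.- (+ n)))) + f -[1+ n ]
      ≈⟨ solve 4 (λ s a b x → (s :+ (a :+ b)) :+ x := ((s :+ b) :+ x) :+ a) refl S′ _ _ _ ⟩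
    ((S′ + f (ℤ.- (+ n))) + f -[1+ n ]) + f (+ suc n)
      ≈⟨ +-congʳ (+-congʳ (sumℤ-suc n f)) ⟩
    ((sumℤ n f + f (+ n)) + f -[1+ n ]) + f (+ suc n)
      ≈⟨ +-congʳ (+-assoc _ _ _) ⟩
    sumℤ (suc n) f + f (+ suc n)
      ∎
    where S′ = sumℤ n (λ k → f (ℤ.suc k))

  private
    translate : ∀ m n f → (∀ j → j ℕ.< m → f (+ j ℤ.+ (+ n)) ≈ 0#) →
      (∀ j → j ℕ.< m → f (+ j ℤ.+ (ℤ.- (+ n))) ≈ 0#) →
      sumℤ n (λ k → f (+ m ℤ.+ k)) ≈ sumℤ n f
    translate zero n f _ _ = sumℤ-cong n (λ k → reflexive (≡.cong f (ℤₚ.+-identityˡ k)))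
    translate (suc m) n f top bottom = begin
      sumℤ n (λ k → f (+ suc m ℤ.+ k))
        ≈⟨ sumℤ-cong n (λ k → reflexive (≡.cong f (reassoc (+ m) k))) ⟩
      sumℤ n (λ k → g (ℤ.suc k))
        ≈⟨ +-identityʳ _ ⟨
      sumℤ n (λ k → g (ℤ.suc k)) + 0#
        ≈⟨ +-congˡ (bottom m (ℕₚ.n<1+n m)) ⟨
      sumℤ n (λ k → g (ℤ.suc k)) + g (ℤ.- (+ n))
        ≈⟨ sumℤ-suc n g ⟩
      sumℤ n g + g (+ n)
        ≈⟨ +-congˡ (top m (ℕₚ.n<1+n m)) ⟩
      sumℤ n g + 0#
        ≈⟨ +-identityʳ _ ⟩
      sumℤ n g
        ≈⟨ translate m n f (λ j j<m → top j (ℕₚ.m<n⇒m<1+n j<m)) (λ j j<m → bottom j (ℕₚ.m<n⇒m<1+n j<m)) ⟩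
      sumℤ n f
        ∎
      where
      g : ℤ → Carrier
      g k = f (+ m ℤ.+ k)
      reassoc : ∀ i k → (ℤ.1ℤ ℤ.+ i) ℤ.+ k ≡ i ℤ.+ (ℤ.1ℤ ℤ.+ k)
      reassoc = solve-∀

    translate⁺ : ∀ m n f → SupportedIn n f → SupportedIn n (λ k → f (+ m ℤ.+ k)) →
      sumℤ n (λ k → f (+ m ℤ.+ k)) ≈ sumℤ n f
    translate⁺ m n f supp supp′ = translate m n f
      (λ j _ → supp _ (ℕₚ.m≤n+m n j))
      -- The low point j - n may lie inside the support radius of `f`. Written as m - (m - j + n),
      -- it is a value of the translated function at an index of size at least n.
      (λ j j<m → trans (reflexive (≡.cong f (eq j j<m))) (supp′ (ℤ.- (+ (m ℕ.∸ j ℕ.+ n)))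
        (ℕₚ.≤-trans (ℕₚ.m≤n+m n (m ℕ.∸ j)) (ℕₚ.≤-reflexive (≡.sym (ℤₚ.∣-i∣≡∣i∣ (+ (m ℕ.∸ j ℕ.+ n))))))))
      where
      ring-eq : ∀ i d n → i ℤ.+ ℤ.- n ≡ (i ℤ.+ d) ℤ.+ ℤ.- (d ℤ.+ n)
      ring-eq = solve-∀
      eq : ∀ j → j ℕ.< m → + j ℤ.+ ℤ.- (+ n) ≡ + m ℤ.+ ℤ.- (+ (m ℕ.∸ j ℕ.+ n))
      eq j j<m = ≡.trans (ring-eq (+ j) (+ (m ℕ.∸ j)) (+ n))
        (≡.cong (λ z → + z ℤ.+ ℤ.- (+ (m ℕ.∸ j ℕ.+ n))) (ℕₚ.m+[n∸m]≡n (ℕₚ.<⇒≤ j<m)))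

  sumℤ-translate : ∀ c n f → SupportedIn n f → SupportedIn n (λ k → f (c ℤ.+ k)) →
    sumℤ n (λ k → f (c ℤ.+ k)) ≈ sumℤ n f
  sumℤ-translate (+ m) n f supp supp′ = translate⁺ m n f supp supp′
  sumℤ-translate -[1+ m ] n f supp supp′ = sym (trans
    (sumℤ-cong n (λ k → back k))
    (translate⁺ (suc m) n (λ k → f (-[1+ m ] ℤ.+ k)) supp′
      (λ k n≤k → trans (sym (back k)) (supp k n≤k))))
    where
    cancel : ∀ i k → k ≡ ℤ.- i ℤ.+ (i ℤ.+ k)
    cancel = solve-∀
    back : ∀ k → f k ≈ f (-[1+ m ] ℤ.+ (+ suc m ℤ.+ k))
    back k = reflexive (≡.cong f (cancel (+ suc m) k))

  -- Since c - (-1 - k) = (c + 1) + k, a reflection is a flip, which needs no support condition,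
  -- combined with a translation by c + 1.
  sumℤ-reflect : ∀ c n f → SupportedIn n f → SupportedIn n (λ k → f (ℤ.suc c ℤ.+ k)) →
    sumℤ n (λ k → f (c ℤ.- k)) ≈ sumℤ n f
  sumℤ-reflect c n f supp supp′ = begin
    sumℤ n (λ k → f (c ℤ.- k))            ≈⟨ sumℤ-flip n (λ k → f (c ℤ.- k)) ⟨
    sumℤ n (λ k → f (c ℤ.- flip-ℤ k))     ≈⟨ sumℤ-cong n (λ k → reflexive (≡.cong f (eq k))) ⟩
    sumℤ n (λ k → f (ℤ.suc c ℤ.+ k))      ≈⟨ sumℤ-translate (ℤ.suc c) n f supp supp′ ⟩
    sumℤ n f                              ∎
    where
    ring-eq : ∀ c k → c ℤ.- (ℤ.- k ℤ.- ℤ.1ℤ) ≡ (ℤ.1ℤ ℤ.+ c) ℤ.+ k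
    ring-eq = solve-∀
    eq : ∀ k → c ℤ.- flip-ℤ k ≡ ℤ.suc c ℤ.+ k
    eq k = ≡.trans (≡.cong (λ z → c ℤ.- z) (flip-ℤ≡ k)) (ring-eq c k)

  -- The indices 2k and 2k + 1 with k in [-n, n) fill [-2n, 2n) exactly, so the sum is first
  -- extended to twice its radius.
  sumℤ-parity : ∀ n f → SupportedIn n f →
    sumℤ n f ≈ sumℤ n (λ k → f (k ℤ.+ k)) + sumℤ n (λ k → f (ℤ.suc (k ℤ.+ k)))
  sumℤ-parity n f supp = trans (sym (sumℤ-extend n n f supp)) (go n)
    where
    go : ∀ n → sumℤ (n ℕ.+ n) f ≈ sumℤ n (λ k → f (k ℤ.+ k)) + sumℤ n (λ k → f (ℤ.suc (k ℤ.+ k)))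
    go zero = sym (+-identityˡ 0#)
    go (suc n) = begin
      sumℤ (suc (n ℕ.+ suc n)) f
        ≈⟨ reflexive (≡.cong (λ m → sumℤ (suc m) f) (ℕₚ.+-suc n n)) ⟩
      (sumℤ (n ℕ.+ n) f + (f (+ (n ℕ.+ n)) + f -[1+ n ℕ.+ n ])) + (f (+ suc (n ℕ.+ n)) + f -[1+ suc (n ℕ.+ n) ])
        ≈⟨ +-congʳ (+-congʳ (go n)) ⟩
      ((S₀ + S₁) + (f (+ (n ℕ.+ n)) + f -[1+ n ℕ.+ n ])) + (f (+ suc (n ℕ.+ n)) + f -[1+ suc (n ℕ.+ n) ])
        ≈⟨ solve 6 (λ s t a b c d → ((s :+ t) :+ (a :+ b)) :+ (c :+ d) := (s :+ (a :+ d)) :+ (t :+ (c :+ b)))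
             refl S₀ S₁ _ _ _ _ ⟩
      sumℤ (suc n) (λ k → f (k ℤ.+ k)) + sumℤ (suc n) (λ k → f (ℤ.suc (k ℤ.+ k)))
        ∎
      where
      S₀ = sumℤ n (λ k → f (k ℤ.+ k))
      S₁ = sumℤ n (λ k → f (ℤ.suc (k ℤ.+ k)))

-- The triple product identity

tri : ℕ → ℕ
tri zero = 0
tri (suc n) = suc n ℕ.+ tri n

-- tri⁺ k = k (k + 1) / 2 and tri⁻ k = k (k - 1) / 2.
tri⁺ tri⁻ : ℤ → ℕ
tri⁺ (+ n) = tri n
tri⁺ -[1+ n ] = tri n
tri⁻ (+ zero) = 0
tri⁻ (+ suc n) = tri n
tri⁻ -[1+ n ] = tri (suc n)

-- The exponent of q in x^(k(k+1)/2) y^(k(k-1)/2) for x = q^a, y = q^c.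
opaque
  expo : ℕ → ℕ → ℤ → ℕ
  expo a c k = a ℕ.* tri⁺ k ℕ.+ c ℕ.* tri⁻ k

tri≡n+tri⁻ : ∀ n → tri n ≡ n ℕ.+ tri⁻ (+ n)
tri≡n+tri⁻ zero = ≡.refl
tri≡n+tri⁻ (suc n) = ≡.refl

opaque
  unfolding expo

  expo-neg : ∀ a c k → expo a c (ℤ.- k) ≡ expo c a k
  expo-neg a c (+ zero) = ℕₚ.+-comm (a ℕ.* 0) (c ℕ.* 0)
  expo-neg a c (+ suc n) = ℕₚ.+-comm (a ℕ.* tri n) (c ℕ.* tri (suc n))
  expo-neg a c -[1+ n ] = ℕₚ.+-comm (a ℕ.* tri (suc n)) (c ℕ.* tri n)

  expo-zero : ∀ a c → expo a c (+ 0) ≡ 0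
  expo-zero a c = ≡.cong₂ ℕ._+_ (ℕₚ.*-zeroʳ a) (ℕₚ.*-zeroʳ c)

  -- The exponent grows by a + (a + c) k from k to k + 1, which may be negative for negative k; the
  -- multiple (a + c) i keeps both sides in ℕ. Here k = n; `expo-pred` is the case k = -1 - n, i = m
  -- + n + 1.
  expo-suc : ∀ a c i n → (a ℕ.+ c) ℕ.* i ℕ.+ expo a c (+ suc n) ≡ (a ℕ.+ (a ℕ.+ c) ℕ.* (i ℕ.+ n)) ℕ.+ expo a c (+ n)
  expo-suc a c i n rewrite tri≡n+tri⁻ n = identity a c i n (tri⁻ (+ n))
    where
    identity : ∀ a c i n t → (a ℕ.+ c) ℕ.* i ℕ.+ (a ℕ.* (suc n ℕ.+ (n ℕ.+ t)) ℕ.+ c ℕ.* (n ℕ.+ t))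
      ≡ (a ℕ.+ (a ℕ.+ c) ℕ.* (i ℕ.+ n)) ℕ.+ (a ℕ.* (n ℕ.+ t) ℕ.+ c ℕ.* t)
    identity = ℕSolver.solve-∀

  expo-pred : ∀ a c m n → (a ℕ.+ c) ℕ.* (m ℕ.+ suc n) ℕ.+ expo c a (+ n) ≡ (a ℕ.+ (a ℕ.+ c) ℕ.* m) ℕ.+ expo a c -[1+ n ]
  expo-pred a c m n rewrite tri≡n+tri⁻ n = identity a c m n (tri⁻ (+ n))
    where
    identity : ∀ a c m n t → (a ℕ.+ c) ℕ.* (m ℕ.+ suc n) ℕ.+ (c ℕ.* (n ℕ.+ t) ℕ.+ a ℕ.* t)
      ≡ (a ℕ.+ (a ℕ.+ c) ℕ.* m) ℕ.+ (a ℕ.* (n ℕ.+ t) ℕ.+ c ℕ.* (suc n ℕ.+ (n ℕ.+ t)))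
    identity = ℕSolver.solve-∀

private
  n≤tri : ∀ n → n ℕ.≤ tri n
  n≤tri zero = ℕ.z≤n
  n≤tri (suc n) = ℕₚ.m≤m+n (suc n) (tri n)

opaque
  unfolding expo

  -- Exponents are at least as large as the index, so truncation at q^N leaves only the terms with
  -- index below N in absolute value.
  ∣k∣≤expo : ∀ a c k → ∣ k ∣ ℕ.≤ expo (suc a) (suc c) k
  ∣k∣≤expo a c (+ n) = ℕₚ.≤-trans (n≤tri n) (ℕₚ.≤-trans (ℕₚ.m≤m+n (tri n) _) (ℕₚ.m≤m+n _ _))
  ∣k∣≤expo a c -[1+ n ] = ℕₚ.≤-trans (n≤tri (suc n))
    (ℕₚ.≤-trans (ℕₚ.m≤m+n (tri (suc n)) _) (ℕₚ.m≤n+m _ (suc a ℕ.* tri n)))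

module Nilpotent {c ℓ} (R : CommutativeRing c ℓ) (q : CommutativeRing.Carrier R) where

  open CommutativeRing R hiding (zero)
  open Exp commutativeSemiring public using (_^_; ^-homo-*; ^-congʳ)
  open Sums R
  open import Relation.Binary.Reasoning.Setoid setoid
  open SemiringSolver commutativeSemiring using (solve; _:=_; _:+_; _:*_; con)

  -- Signs are written as powers of this atom, so that most identities are identities of commutative
  -- semirings; `1+ν≈0` supplies the cancellations.
  ν : Carrier
  ν = - 1#

  1+ν≈0 : 1# + ν ≈ 0#
  1+ν≈0 = -‿inverseʳ 1#

  ν*ν≈1 : ν * ν ≈ 1#
  ν*ν≈1 = begin
    ν * ν                      ≈⟨ solve 1 (λ n → n :* n := n :* n :+ con 0) refl ν ⟩
    ν * ν + 0#                 ≈⟨ +-congˡ 1+ν≈0 ⟨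
    ν * ν + (1# + ν)           ≈⟨ solve 1 (λ n → n :* n :+ (con 1 :+ n) := con 1 :+ n :* (con 1 :+ n)) refl ν ⟩
    1# + ν * (1# + ν)          ≈⟨ +-congˡ (trans (*-congˡ 1+ν≈0) (zeroʳ ν)) ⟩
    1# + 0#                    ≈⟨ +-identityʳ 1# ⟩
    1#                         ∎

  x+νx≈0 : ∀ x → x + ν * x ≈ 0#
  x+νx≈0 x = begin
    x + ν * x       ≈⟨ solve 2 (λ x n → x :+ n :* x := (con 1 :+ n) :* x) refl x ν ⟩
    (1# + ν) * x    ≈⟨ trans (*-congʳ 1+ν≈0) (zeroˡ x) ⟩
    0#              ∎

  transpose : ∀ {u v x y} → u + v ≈ x + y → u + ν * y ≈ x + ν * v
  transpose {u} {v} {x} {y} eq = begin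
    u + ν * y                        ≈⟨ +-identityʳ _ ⟨
    u + ν * y + 0#                   ≈⟨ +-congˡ (x+νx≈0 v) ⟨
    u + ν * y + (v + ν * v)          ≈⟨ solve 4 (λ u v y n → u :+ n :* y :+ (v :+ n :* v) := (u :+ v) :+ (n :* y :+ n :* v)) refl u v y ν ⟩
    (u + v) + (ν * y + ν * v)        ≈⟨ +-congʳ eq ⟩
    (x + y) + (ν * y + ν * v)        ≈⟨ solve 4 (λ x v y n → (x :+ y) :+ (n :* y :+ n :* v) := (x :+ n :* v) :+ (y :+ n :* y)) refl x v y ν ⟩
    (x + ν * v) + (y + ν * y)        ≈⟨ +-congˡ (x+νx≈0 y) ⟩
    (x + ν * v) + 0#                 ≈⟨ +-identityʳ _ ⟩
    x + ν * v                        ∎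

  q^ : ∀ {m n} → m ≡ n → q ^ m ≈ q ^ n
  q^ = ^-congʳ q

  factor : Carrier → ℕ → Carrier
  factor s e = 1# + s * q ^ e

  *-factor₁ : ∀ x e → x * factor 1# e ≈ x + q ^ e * x
  *-factor₁ x e = solve 2 (λ x y → x :* (con 1 :+ con 1 :* y) := x :+ y :* x) refl x (q ^ e)

  part : (ℕ → Bool) → ℕ → Carrier
  part p k = if p k then factor 1# k else 1#

  -- The q-Pochhammer symbol (-s q^a; q^d)_n.
  progression : Carrier → ℕ → ℕ → ℕ → Carrier
  progression s a d n = prod n (λ i → factor s (a ℕ.+ d ℕ.* i))

  progression-thirds : ∀ s a d {b c e} n → a ℕ.+ d ≡ b → b ℕ.+ d ≡ c → d ℕ.+ d ℕ.+ d ≡ e →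
    progression s a d (n ℕ.* 3) ≈ progression s a e n * progression s b e n * progression s c e n
  progression-thirds s a d n ≡.refl ≡.refl ≡.refl = begin
    progression s a d (n ℕ.* 3)
      ≈⟨ prod-blocks 3 n _ ⟩
    prod n (λ i → 1# * factor s (a ℕ.+ d ℕ.* (i ℕ.* 3)) * factor s (a ℕ.+ d ℕ.* (1 ℕ.+ i ℕ.* 3)) * factor s (a ℕ.+ d ℕ.* (2 ℕ.+ i ℕ.* 3)))
      ≈⟨ prod-cong n (λ i → *-cong (*-cong (trans (*-identityˡ _) (factor-cong (first a d i)))
           (factor-cong (second a d i))) (factor-cong (third a d i))) ⟩
    prod n (λ i → factor s (a ℕ.+ e ℕ.* i) * factor s (a ℕ.+ d ℕ.+ e ℕ.* i) * factor s (a ℕ.+ d ℕ.+ d ℕ.+ e ℕ.* i))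
      ≈⟨ trans (prod-* n _ _) (*-congʳ (prod-* n _ _)) ⟩
    progression s a e n * progression s (a ℕ.+ d) e n * progression s (a ℕ.+ d ℕ.+ d) e n
      ∎
    where
    e = d ℕ.+ d ℕ.+ d
    factor-cong : ∀ {i j} → i ≡ j → factor s i ≈ factor s j
    factor-cong eq = +-congˡ (*-congˡ (q^ eq))
    first : ∀ a d i → a ℕ.+ d ℕ.* (i ℕ.* 3) ≡ a ℕ.+ (d ℕ.+ d ℕ.+ d) ℕ.* i
    first = ℕSolver.solve-∀
    second : ∀ a d i → a ℕ.+ d ℕ.* (1 ℕ.+ i ℕ.* 3) ≡ a ℕ.+ d ℕ.+ (d ℕ.+ d ℕ.+ d) ℕ.* i
    second = ℕSolver.solve-∀
    third : ∀ a d i → a ℕ.+ d ℕ.* (2 ℕ.+ i ℕ.* 3) ≡ a ℕ.+ d ℕ.+ d ℕ.+ (d ℕ.+ d ℕ.+ d) ℕ.* i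
    third = ℕSolver.solve-∀

  -- Gaussian binomial coefficients

  module Gaussian (d : ℕ) where

    p^ : ℕ → Carrier
    p^ n = q ^ (d ℕ.* n)

    p^-+ : ∀ m n → p^ m * p^ n ≈ p^ (m ℕ.+ n)
    p^-+ m n = trans (sym (^-homo-* q (d ℕ.* m) (d ℕ.* n))) (q^ (≡.sym (ℕₚ.*-distribˡ-+ d m n)))

    p^0 : p^ 0 ≈ 1#
    p^0 = q^ (ℕₚ.*-zeroʳ d)

    -- The Gaussian binomial coefficient [a + b, a] in base q^d.
    gauss : ℕ → ℕ → Carrier
    gauss zero b = 1#
    gauss (suc a) zero = 1#
    gauss (suc a) (suc b) = gauss a (suc b) + p^ (suc a) * gauss (suc a) b

    gauss-zeroʳ : ∀ a → gauss a 0 ≈ 1#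
    gauss-zeroʳ zero = refl
    gauss-zeroʳ (suc a) = refl

    private
      -- Quotients of neighbouring coefficients, [a, b + 1] (1 - p^(b+1)) = [a, b] (1 - p^(a+b+1))
      -- and its mirror image, with the subtracted terms moved across; here [a, b] is `gauss a b`.
      -- At (a, b) they yield the second Pascal rule, which yields them at the next index.
      ratioʳ : ∀ a b → gauss a (suc b) + p^ (suc (a ℕ.+ b)) * gauss a b ≈ gauss a b + p^ (suc b) * gauss a (suc b)
      ratioˡ : ∀ a b → gauss (suc a) b + p^ (suc (a ℕ.+ b)) * gauss a b ≈ gauss a b + p^ (suc a) * gauss (suc a) b

    -- The companion of the defining Pascal rule: the two rules serve for adding a factor to one or
    -- the other progression of the triple product.
    gauss-pascal : ∀ a b → gauss (suc a) (suc b) ≈ gauss (suc a) b + p^ (suc b) * gauss a (suc b)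
    gauss-pascal a b = +-cancelʳ _ _ _ (begin
      (x + P * y) + (z + T * z)      ≈⟨ solve 6 (λ x y z P Q T → (x :+ P :* y) :+ (z :+ T :* z) := (x :+ T :* z) :+ (z :+ P :* y)) refl x y z P Q T ⟩
      (x + T * z) + (z + P * y)      ≈⟨ +-cong (ratioʳ a b) (sym (ratioˡ a b)) ⟩
      (z + Q * x) + (y + T * z)      ≈⟨ solve 6 (λ x y z P Q T → (z :+ Q :* x) :+ (y :+ T :* z) := (y :+ Q :* x) :+ (z :+ T :* z)) refl x y z P Q T ⟩
      (y + Q * x) + (z + T * z)      ∎)
      where
      open import Algebra.Properties.Ring ring using (+-cancelʳ)
      x = gauss a (suc b)
      y = gauss (suc a) b
      z = gauss a b
      P = p^ (suc a)
      Q = p^ (suc b)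
      T = p^ (suc (a ℕ.+ b))

    ratioʳ zero b = refl
    ratioʳ (suc a) b = begin
      gauss (suc a) (suc b) + T * y      ≈⟨ +-cong (gauss-pascal a b) (*-congʳ (sym (trans (p^-+ (suc b) (suc a)) (q^ (≡.cong (d ℕ.*_) (eq a b)))))) ⟩
      y + Q * x + Q * P * y              ≈⟨ solve 4 (λ x y P Q → y :+ Q :* x :+ Q :* P :* y := y :+ Q :* (x :+ P :* y)) refl x y P Q ⟩
      y + Q * (x + P * y)                ∎
      where
      x = gauss a (suc b)
      y = gauss (suc a) b
      P = p^ (suc a)
      Q = p^ (suc b)
      T = p^ (suc (suc a ℕ.+ b))
      eq : ∀ a b → suc b ℕ.+ suc a ≡ suc (suc a ℕ.+ b)
      eq a b = ≡.cong suc (≡.trans (ℕₚ.+-suc b a) (≡.cong suc (ℕₚ.+-comm b a)))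

    ratioˡ a zero = +-cong (sym (gauss-zeroʳ a))
      (*-cong (q^ (≡.cong (λ n → d ℕ.* suc n) (ℕₚ.+-identityʳ a))) (gauss-zeroʳ a))
    ratioˡ a (suc b) = begin
      (x + P * y) + T * x                ≈⟨ +-congˡ (*-congʳ (p^-+ (suc a) (suc b))) ⟨
      (x + P * y) + P * Q * x            ≈⟨ solve 4 (λ x y P Q → (x :+ P :* y) :+ P :* Q :* x := x :+ P :* (y :+ Q :* x)) refl x y P Q ⟩
      x + P * (y + Q * x)                ≈⟨ +-congˡ (*-congˡ (gauss-pascal a b)) ⟨
      x + P * gauss (suc a) (suc b)      ∎
      where
      x = gauss a (suc b)
      y = gauss (suc a) b
      P = p^ (suc a)
      Q = p^ (suc b)
      T = p^ (suc (a ℕ.+ suc b))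

    pochhammer : ℕ → Carrier
    pochhammer = progression ν d d

    -- The right-hand side is (p^(a+1); p)_b with p = q^d. For positive d it becomes 1 when q^N = 0
    -- and a ≥ N, so that the Gaussian coefficient inverts Euler's product.
    gauss*pochhammer : ∀ a b → gauss a b * pochhammer b ≈ prod b (λ i → 1# + ν * p^ (suc (a ℕ.+ i)))
    gauss*pochhammer a zero = trans (*-identityʳ _) (gauss-zeroʳ a)
    gauss*pochhammer a (suc b) = begin
      x * (e * factor ν (d ℕ.+ d ℕ.* b))
        ≈⟨ *-congˡ (*-congˡ (+-congˡ (*-congˡ (q^ (≡.sym (ℕₚ.*-suc d b)))))) ⟩
      x * (e * (1# + ν * Q))
        ≈⟨ solve 4 (λ x e n Q → x :* (e :* (con 1 :+ n :* Q)) := (x :+ n :* (Q :* x)) :* e) refl x e ν Q ⟩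
      (x + ν * (Q * x)) * e
        ≈⟨ *-congʳ (transpose (ratioʳ a b)) ⟩
      (z + ν * (T * z)) * e
        ≈⟨ solve 4 (λ z e n T → (z :+ n :* (T :* z)) :* e := (z :* e) :* (con 1 :+ n :* T)) refl z e ν T ⟩
      (z * e) * (1# + ν * T)
        ≈⟨ *-congʳ (gauss*pochhammer a b) ⟩
      prod (suc b) (λ i → 1# + ν * p^ (suc (a ℕ.+ i)))
        ∎
      where
      x = gauss a (suc b)
      z = gauss a b
      e = pochhammer b
      Q = p^ (suc b)
      T = p^ (suc (a ℕ.+ b))

  module Theta (s : Carrier) (s*s≈1 : s * s ≈ 1#) where

    -- The general term of f(s q^a, s q^c): its power of s is s^(k²), which by `s * s ≈ 1` depends
    -- only on the parity of k.
    theta : ℕ → ℕ → ℤ → Carrier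
    theta a c k = s ^ ∣ k ∣ * q ^ expo a c k

    theta-neg : ∀ a c k → theta a c (ℤ.- k) ≈ theta c a k
    theta-neg a c k = *-cong (^-congʳ s (ℤₚ.∣-i∣≡∣i∣ k)) (q^ (expo-neg a c k))

    -- The quotient of consecutive terms is s q^(a + (a + c) k). As q is not invertible, the
    -- relation is multiplied by q^((a + c) i), with i + k = m nonnegative.
    theta-suc : ∀ a c k i m → + i ℤ.+ k ≡ + m →
      q ^ ((a ℕ.+ c) ℕ.* i) * theta a c (ℤ.suc k) ≈ s * q ^ (a ℕ.+ (a ℕ.+ c) ℕ.* m) * theta a c k
    theta-suc a c (+ n) i m eq with ℤₚ.+-injective eq
    ... | ≡.refl = begin
      q ^ (d ℕ.* i) * (s * s ^ n * q ^ expo a c (+ suc n))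
        ≈⟨ solve 4 (λ x s y z → x :* (s :* y :* z) := s :* y :* (x :* z)) refl (q ^ (d ℕ.* i)) s (s ^ n) _ ⟩
      s * s ^ n * (q ^ (d ℕ.* i) * q ^ expo a c (+ suc n))
        ≈⟨ *-congˡ (^-homo-* q (d ℕ.* i) (expo a c (+ suc n))) ⟨
      s * s ^ n * q ^ (d ℕ.* i ℕ.+ expo a c (+ suc n))
        ≈⟨ *-congˡ (q^ (expo-suc a c i n)) ⟩
      s * s ^ n * q ^ ((a ℕ.+ d ℕ.* (i ℕ.+ n)) ℕ.+ expo a c (+ n))
        ≈⟨ *-congˡ (^-homo-* q (a ℕ.+ d ℕ.* (i ℕ.+ n)) (expo a c (+ n))) ⟩
      s * s ^ n * (q ^ (a ℕ.+ d ℕ.* (i ℕ.+ n)) * q ^ expo a c (+ n))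
        ≈⟨ solve 4 (λ x s y z → s :* y :* (x :* z) := s :* x :* (y :* z)) refl (q ^ (a ℕ.+ d ℕ.* (i ℕ.+ n))) s (s ^ n) _ ⟩
      s * q ^ (a ℕ.+ d ℕ.* (i ℕ.+ n)) * theta a c (+ n)
        ∎
      where
      d = a ℕ.+ c
    theta-suc a c -[1+ n ] i m eq = begin
      q ^ (d ℕ.* i) * theta a c (ℤ.suc -[1+ n ])
        ≈⟨ *-congˡ (trans (reflexive (≡.cong (theta a c) (suc-neg n))) (theta-neg a c (+ n))) ⟩
      q ^ (d ℕ.* i) * (s ^ n * q ^ expo c a (+ n))
        ≈⟨ solve 3 (λ x y z → x :* (y :* z) := con 1 :* y :* (x :* z)) refl (q ^ (d ℕ.* i)) (s ^ n) _ ⟩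
      1# * s ^ n * (q ^ (d ℕ.* i) * q ^ expo c a (+ n))
        ≈⟨ *-cong (*-congʳ s*s≈1) (^-homo-* q (d ℕ.* i) (expo c a (+ n))) ⟨
      s * s * s ^ n * q ^ (d ℕ.* i ℕ.+ expo c a (+ n))
        ≈⟨ *-congˡ (q^ exponents) ⟩
      s * s * s ^ n * q ^ ((a ℕ.+ d ℕ.* m) ℕ.+ expo a c -[1+ n ])
        ≈⟨ *-congˡ (^-homo-* q (a ℕ.+ d ℕ.* m) (expo a c -[1+ n ])) ⟩
      s * s * s ^ n * (q ^ (a ℕ.+ d ℕ.* m) * q ^ expo a c -[1+ n ])
        ≈⟨ solve 4 (λ x s y z → s :* s :* y :* (x :* z) := s :* x :* (s :* y :* z)) refl (q ^ (a ℕ.+ d ℕ.* m)) s (s ^ n) _ ⟩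
      s * q ^ (a ℕ.+ d ℕ.* m) * theta a c -[1+ n ]
        ∎
      where
      d = a ℕ.+ c
      i≡ : i ≡ m ℕ.+ suc n
      i≡ = ℤₚ.+-injective (≡.trans (cancel (+ i) (+ suc n)) (≡.cong (ℤ._+ + suc n) eq))
        where
        cancel : ∀ i n → i ≡ (i ℤ.+ ℤ.- n) ℤ.+ n
        cancel = solve-∀
      exponents : d ℕ.* i ℕ.+ expo c a (+ n) ≡ (a ℕ.+ d ℕ.* m) ℕ.+ expo a c -[1+ n ]
      exponents = ≡.trans (≡.cong (λ z → d ℕ.* z ℕ.+ expo c a (+ n)) i≡) (expo-pred a c m n)

    theta-pred : ∀ a c k i m → + i ℤ.- k ≡ + m →
      q ^ ((a ℕ.+ c) ℕ.* i) * theta a c (ℤ.pred k) ≈ s * q ^ (c ℕ.+ (a ℕ.+ c) ℕ.* m) * theta a c k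
    theta-pred a c k i m eq = begin
      q ^ ((a ℕ.+ c) ℕ.* i) * theta a c (ℤ.pred k)
        ≈⟨ *-cong (q^ (≡.cong (ℕ._* i) (ℕₚ.+-comm a c)))
             (trans (reflexive (≡.cong (theta a c) (double-neg k))) (theta-neg a c (ℤ.suc (ℤ.- k)))) ⟩
      q ^ ((c ℕ.+ a) ℕ.* i) * theta c a (ℤ.suc (ℤ.- k))
        ≈⟨ theta-suc c a (ℤ.- k) i m eq ⟩
      s * q ^ (c ℕ.+ (c ℕ.+ a) ℕ.* m) * theta c a (ℤ.- k)
        ≈⟨ *-cong (*-congˡ (q^ (≡.cong (λ d → c ℕ.+ d ℕ.* m) (ℕₚ.+-comm c a)))) (theta-neg c a k) ⟩
      s * q ^ (c ℕ.+ (a ℕ.+ c) ℕ.* m) * theta a c k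
        ∎
      where
      double-neg : ∀ k → ℤ.- ℤ.1ℤ ℤ.+ k ≡ ℤ.- (ℤ.1ℤ ℤ.+ ℤ.- k)
      double-neg = solve-∀

    module _ (a c : ℕ) where

      private
        d = a ℕ.+ c
        t = theta a c

      open Gaussian d

      private
        shifted : ℕ → ℕ → ℕ → Carrier
        shifted n i j = gauss i j * t (+ i ℤ.- + n)

        multiply : ∀ N n e → diag N (shifted n) * factor s e
          ≈ diag N (shifted n) + diag N (λ i j → s * q ^ e * shifted n i j)
        multiply N n e = trans (solve 2 (λ x y → x :* (con 1 :+ y) := x :+ y :* x) refl _ _) (+-congˡ (diag-*ˡ N _ _))

        -- Multiplication by s q^(c + d n) moves the theta term at i - n one index down and leaves
        -- the factor p^i; the two summands then combine by the defining Pascal rule, and the lowest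
        -- index becomes -(n + 1).
        step-c : ∀ N n → diag N (shifted n) * factor s (c ℕ.+ d ℕ.* n) ≈ diag (suc N) (shifted (suc n))
        step-c N n = begin
          diag N (shifted n) * factor s (c ℕ.+ d ℕ.* n)
            ≈⟨ multiply N n (c ℕ.+ d ℕ.* n) ⟩
          diag N (shifted n) + diag N (λ i j → s * q ^ (c ℕ.+ d ℕ.* n) * shifted n i j)
            ≈⟨ +-comm _ _ ⟩
          diag N (λ i j → s * q ^ (c ℕ.+ d ℕ.* n) * shifted n i j) + diag N (shifted n)
            ≈⟨ +-congʳ (diag-cong N (λ i j _ → relate i j)) ⟩
          diag N (λ i j → p^ i * shifted (suc n) i j) + diag N (shifted n)
            ≈⟨ diag-pascal N (shifted (suc n)) (λ i j → p^ i * shifted (suc n) i j) (shifted n) left right inner ⟨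
          diag (suc N) (shifted (suc n))
            ∎
          where
          pred-eq : ∀ i n → ℤ.- ℤ.1ℤ ℤ.+ (i ℤ.- n) ≡ i ℤ.- (ℤ.1ℤ ℤ.+ n)
          pred-eq = solve-∀
          cancel : ∀ i n → i ℤ.- (i ℤ.- n) ≡ n
          cancel = solve-∀
          suc-eq : ∀ i n → (ℤ.1ℤ ℤ.+ i) ℤ.- (ℤ.1ℤ ℤ.+ n) ≡ i ℤ.- n
          suc-eq = solve-∀
          relate : ∀ i j → s * q ^ (c ℕ.+ d ℕ.* n) * shifted n i j ≈ p^ i * shifted (suc n) i j
          relate i j = begin
            s * q ^ (c ℕ.+ d ℕ.* n) * (gauss i j * t (+ i ℤ.- + n))
              ≈⟨ solve 3 (λ x g y → x :* (g :* y) := g :* (x :* y)) refl _ (gauss i j) _ ⟩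
            gauss i j * (s * q ^ (c ℕ.+ d ℕ.* n) * t (+ i ℤ.- + n))
              ≈⟨ *-congˡ (theta-pred a c (+ i ℤ.- + n) i n (cancel (+ i) (+ n))) ⟨
            gauss i j * (p^ i * t (ℤ.pred (+ i ℤ.- + n)))
              ≈⟨ *-congˡ (*-congˡ (reflexive (≡.cong t (pred-eq (+ i) (+ n))))) ⟩
            gauss i j * (p^ i * t (+ i ℤ.- + suc n))
              ≈⟨ solve 3 (λ g x y → g :* (x :* y) := x :* (g :* y)) refl (gauss i j) _ _ ⟩
            p^ i * (gauss i j * t (+ i ℤ.- + suc n))
              ∎
          left : ∀ j → shifted (suc n) 0 (suc j) ≈ p^ 0 * shifted (suc n) 0 j
          left j = sym (trans (*-congʳ p^0) (*-identityˡ _))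
          right : ∀ i → shifted (suc n) (suc i) 0 ≈ shifted n i 0
          right i = *-cong (sym (gauss-zeroʳ i)) (reflexive (≡.cong t (suc-eq (+ i) (+ n))))
          inner : ∀ i j → shifted (suc n) (suc i) (suc j) ≈ p^ (suc i) * shifted (suc n) (suc i) j + shifted n i (suc j)
          inner i j = begin
            (gauss i (suc j) + p^ (suc i) * gauss (suc i) j) * t (+ suc i ℤ.- + suc n)
              ≈⟨ solve 4 (λ x y z u → (x :+ y :* z) :* u := y :* (z :* u) :+ x :* u) refl _ _ _ _ ⟩
            p^ (suc i) * shifted (suc n) (suc i) j + gauss i (suc j) * t (+ suc i ℤ.- + suc n)
              ≈⟨ +-congˡ (*-congˡ (reflexive (≡.cong t (suc-eq (+ i) (+ n))))) ⟩
            p^ (suc i) * shifted (suc n) (suc i) j + shifted n i (suc j)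
              ∎

        -- Multiplication by s q^(a + d m) moves the theta term one index up and leaves p^j, because
        -- i + j = m + n; here the second Pascal rule applies.
        step-a : ∀ m n → diag (m ℕ.+ n) (shifted n) * factor s (a ℕ.+ d ℕ.* m) ≈ diag (suc m ℕ.+ n) (shifted n)
        step-a m n = begin
          diag (m ℕ.+ n) (shifted n) * factor s (a ℕ.+ d ℕ.* m)
            ≈⟨ multiply (m ℕ.+ n) n (a ℕ.+ d ℕ.* m) ⟩
          diag (m ℕ.+ n) (shifted n) + diag (m ℕ.+ n) (λ i j → s * q ^ (a ℕ.+ d ℕ.* m) * shifted n i j)
            ≈⟨ +-congˡ (diag-cong (m ℕ.+ n) relate) ⟩
          diag (m ℕ.+ n) (shifted n) + diag (m ℕ.+ n) (λ i j → p^ j * (gauss i j * t (+ suc i ℤ.- + n)))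
            ≈⟨ diag-pascal (m ℕ.+ n) (shifted n) (shifted n) (λ i j → p^ j * (gauss i j * t (+ suc i ℤ.- + n)))
                 (λ j → refl) right inner ⟨
          diag (suc m ℕ.+ n) (shifted n)
            ∎
          where
          suc-eq : ∀ i n → ℤ.1ℤ ℤ.+ (i ℤ.- n) ≡ (ℤ.1ℤ ℤ.+ i) ℤ.- n
          suc-eq = solve-∀
          cancel : ∀ m n → (m ℤ.+ n) ℤ.- n ≡ m
          cancel = solve-∀
          regroup : ∀ i j n → j ℤ.+ (i ℤ.- n) ≡ (i ℤ.+ j) ℤ.- n
          regroup = solve-∀
          relate : ∀ i j → i ℕ.+ j ≡ m ℕ.+ n →
            s * q ^ (a ℕ.+ d ℕ.* m) * shifted n i j ≈ p^ j * (gauss i j * t (+ suc i ℤ.- + n))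
          relate i j eq = begin
            s * q ^ (a ℕ.+ d ℕ.* m) * (gauss i j * t (+ i ℤ.- + n))
              ≈⟨ solve 3 (λ x g y → x :* (g :* y) := g :* (x :* y)) refl _ (gauss i j) _ ⟩
            gauss i j * (s * q ^ (a ℕ.+ d ℕ.* m) * t (+ i ℤ.- + n))
              ≈⟨ *-congˡ (theta-suc a c (+ i ℤ.- + n) j m (≡.trans (regroup (+ i) (+ j) (+ n))
                   (≡.trans (≡.cong (λ z → + z ℤ.- + n) eq) (cancel (+ m) (+ n))))) ⟨
            gauss i j * (p^ j * t (ℤ.suc (+ i ℤ.- + n)))
              ≈⟨ *-congˡ (*-congˡ (reflexive (≡.cong t (suc-eq (+ i) (+ n))))) ⟩
            gauss i j * (p^ j * t (+ suc i ℤ.- + n))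
              ≈⟨ solve 3 (λ g x y → g :* (x :* y) := x :* (g :* y)) refl (gauss i j) _ _ ⟩
            p^ j * (gauss i j * t (+ suc i ℤ.- + n))
              ∎
          right : ∀ i → shifted n (suc i) 0 ≈ p^ 0 * (gauss i 0 * t (+ suc i ℤ.- + n))
          right i = sym (trans (*-congʳ p^0) (trans (*-identityˡ _) (*-congʳ (gauss-zeroʳ i))))
          inner : ∀ i j → shifted n (suc i) (suc j)
            ≈ shifted n (suc i) j + p^ (suc j) * (gauss i (suc j) * t (+ suc i ℤ.- + n))
          inner i j = trans (*-congʳ (gauss-pascal i j))
            (solve 4 (λ x y z u → (x :+ y :* z) :* u := x :* u :+ y :* (z :* u)) refl _ _ _ _)

      -- The finite form of Jacobi's triple product: every new factor is one Pascal step between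
      -- antidiagonals.
      triple-product-finite : ∀ m n →
        progression s a d m * progression s c d n ≈ diag (m ℕ.+ n) (λ i j → gauss i j * t (+ i ℤ.- + n))
      triple-product-finite zero zero = *-congˡ (sym (trans (*-identityˡ _) (q^ (expo-zero a c))))
      triple-product-finite zero (suc n) = begin
        1# * (progression s c d n * factor s (c ℕ.+ d ℕ.* n))
          ≈⟨ *-assoc _ _ _ ⟨
        1# * progression s c d n * factor s (c ℕ.+ d ℕ.* n)
          ≈⟨ *-congʳ (triple-product-finite zero n) ⟩
        diag n (shifted n) * factor s (c ℕ.+ d ℕ.* n)
          ≈⟨ step-c n n ⟩
        diag (suc n) (shifted (suc n))
          ∎
      triple-product-finite (suc m) n = begin
        progression s a d m * factor s (a ℕ.+ d ℕ.* m) * progression s c d n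
          ≈⟨ solve 3 (λ x y z → x :* y :* z := x :* z :* y) refl _ _ _ ⟩
        progression s a d m * progression s c d n * factor s (a ℕ.+ d ℕ.* m)
          ≈⟨ *-congʳ (triple-product-finite m n) ⟩
        diag (m ℕ.+ n) (shifted n) * factor s (a ℕ.+ d ℕ.* m)
          ≈⟨ step-a m n ⟩
        diag (suc m ℕ.+ n) (shifted n)
          ∎

  module Truncated (N : ℕ) (q^N≈0 : q ^ N ≈ 0#) where

    q^-vanishes : ∀ {e} → N ℕ.≤ e → q ^ e ≈ 0#
    q^-vanishes {e} N≤e = begin
      q ^ e                          ≈⟨ q^ (ℕₚ.m+[n∸m]≡n N≤e) ⟨
      q ^ (N ℕ.+ (e ℕ.∸ N))          ≈⟨ ^-homo-* q N _ ⟩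
      q ^ N * q ^ (e ℕ.∸ N)          ≈⟨ trans (*-congʳ q^N≈0) (zeroˡ _) ⟩
      0#                             ∎

    factor-trivial : ∀ s {e} → N ℕ.≤ e → factor s e ≈ 1#
    factor-trivial s N≤e = trans (+-congˡ (trans (*-congˡ (q^-vanishes N≤e)) (zeroʳ s))) (+-identityʳ 1#)

    progression-stable : ∀ s a d {m} → N ℕ.≤ m → progression s a (suc d) m ≈ progression s a (suc d) N
    progression-stable s a d {m} N≤m = begin
      progression s a (suc d) m
        ≈⟨ reflexive (≡.cong (progression s a (suc d)) (ℕₚ.m∸n+n≡m N≤m)) ⟨
      progression s a (suc d) (m ℕ.∸ N ℕ.+ N)
        ≈⟨ prod-++ N (m ℕ.∸ N) _ ⟩
      progression s a (suc d) N * prod (m ℕ.∸ N) (λ i → factor s (a ℕ.+ suc d ℕ.* (i ℕ.+ N)))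
        ≈⟨ *-congˡ (prod-1 (m ℕ.∸ N) _ (λ i → factor-trivial s (bound i))) ⟩
      progression s a (suc d) N * 1#
        ≈⟨ *-identityʳ _ ⟩
      progression s a (suc d) N
        ∎
      where
      bound : ∀ i → N ℕ.≤ a ℕ.+ suc d ℕ.* (i ℕ.+ N)
      bound i = ℕₚ.≤-trans (ℕₚ.m≤n+m N i) (ℕₚ.≤-trans (ℕₚ.m≤m+n (i ℕ.+ N) _) (ℕₚ.m≤n+m _ a))

    -- Euler's product is stable beyond N factors, so m may be replaced by b; then every exponent in
    -- (p^(a+1); p)_b is at least N.
    gauss-inverse : ∀ d {a b m} → N ℕ.≤ a → N ℕ.≤ b → N ℕ.≤ m →
      Gaussian.gauss (suc d) a b * progression ν (suc d) (suc d) m ≈ 1#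
    gauss-inverse d {a} {b} {m} N≤a N≤b N≤m = begin
      gauss a b * pochhammer m
        ≈⟨ *-congˡ (trans (progression-stable ν (suc d) d N≤m) (sym (progression-stable ν (suc d) d N≤b))) ⟩
      gauss a b * pochhammer b
        ≈⟨ gauss*pochhammer a b ⟩
      prod b (λ i → factor ν (suc d ℕ.* suc (a ℕ.+ i)))
        ≈⟨ prod-1 b _ (λ i → factor-trivial ν (bound i)) ⟩
      1#
        ∎
      where
      open Gaussian (suc d)
      bound : ∀ i → N ℕ.≤ suc d ℕ.* suc (a ℕ.+ i)
      bound i = ℕₚ.≤-trans N≤a (ℕₚ.≤-trans (ℕₚ.m≤n⇒m≤1+n (ℕₚ.m≤m+n a i)) (ℕₚ.m≤m+n _ _))

    module _ (s : Carrier) (s*s≈1 : s * s ≈ 1#) (a c : ℕ) where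

      open Theta s s*s≈1

      theta-support : SupportedIn N (theta (suc a) (suc c))
      theta-support k N≤k = trans (*-congˡ (q^-vanishes (ℕₚ.≤-trans N≤k (∣k∣≤expo a c k)))) (zeroʳ _)

      private
        d = a ℕ.+ suc c
        t = theta (suc a) (suc c)
        open Gaussian (suc d)

        ∣-∣-sym : ∀ i j → ∣ + i ℤ.- + j ∣ ≡ ∣ + j ℤ.- + i ∣
        ∣-∣-sym i j = ≡.trans (≡.sym (ℤₚ.∣-i∣≡∣i∣ (+ i ℤ.- + j))) (≡.cong ∣_∣ (swap (+ i) (+ j)))
          where
          swap : ∀ i j → ℤ.- (i ℤ.- j) ≡ j ℤ.- i
          swap = solve-∀

        far : ∀ {i L} → N ℕ.+ N ℕ.≤ L → i ℕ.< N → N ℕ.≤ ∣ + i ℤ.- + L ∣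
        far {i} {L} 2N≤L i<N = ≡.subst (N ℕ.≤_) (≡.trans (≡.cong ∣_∣ (≡.sym (≡.trans (ℤₚ.m-n≡m⊖n L i) (ℤₚ.⊖-≥ i≤L)))) (∣-∣-sym L i))
          (ℕₚ.m+n≤o⇒m≤o∸n N (ℕₚ.≤-trans (ℕₚ.+-monoʳ-≤ N (ℕₚ.<⇒≤ i<N)) 2N≤L))
          where
          i≤L : i ℕ.≤ L
          i≤L = ℕₚ.≤-trans (ℕₚ.<⇒≤ i<N) (ℕₚ.≤-trans (ℕₚ.m≤m+n N N) 2N≤L)

        mirror : ∀ {i j L} → i ℕ.+ j ≡ L ℕ.+ L → + j ℤ.- + L ≡ + L ℤ.- + i
        mirror {i} {j} {L} eq = ≡.trans (shift (+ i) (+ j) (+ L)) (≡.trans (≡.cong (λ z → + z ℤ.- + i ℤ.- + L) eq) (unshift (+ i) (+ L)))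
          where
          shift : ∀ i j L → j ℤ.- L ≡ (i ℤ.+ j) ℤ.- i ℤ.- L
          shift = solve-∀
          unshift : ∀ i L → (L ℤ.+ L) ℤ.- i ℤ.- L ≡ L ℤ.- i
          unshift = solve-∀

        -- If i and j are both at least N, the Gaussian coefficient cancels Euler's product.
        -- Otherwise i - L has absolute value at least N, because L ≥ 2N, and the theta term is 0 on
        -- both sides.
        coefficient : ∀ {L} → N ℕ.+ N ℕ.≤ L → ∀ i j → i ℕ.+ j ≡ L ℕ.+ L →
          pochhammer L * (gauss i j * t (+ i ℤ.- + L)) ≈ t (+ i ℤ.- + L)
        coefficient {L} 2N≤L i j eq with N ℕ.≤? i | N ℕ.≤? j
        ... | yes N≤i | yes N≤j = begin
          pochhammer L * (gauss i j * t k)       ≈⟨ solve 3 (λ x y z → x :* (y :* z) := y :* x :* z) refl _ _ _ ⟩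
          gauss i j * pochhammer L * t k         ≈⟨ *-congʳ (gauss-inverse d N≤i N≤j (ℕₚ.≤-trans (ℕₚ.m≤m+n N N) 2N≤L)) ⟩
          1# * t k                               ≈⟨ *-identityˡ _ ⟩
          t k                                    ∎
          where k = + i ℤ.- + L
        ... | no N≰i | _ = trans (*-congˡ (trans (*-congˡ t≈0) (zeroʳ _))) (trans (zeroʳ _) (sym t≈0))
          where
          t≈0 = theta-support (+ i ℤ.- + L) (far 2N≤L (ℕₚ.≰⇒> N≰i))
        ... | yes _ | no N≰j = trans (*-congˡ (trans (*-congˡ t≈0) (zeroʳ _))) (trans (zeroʳ _) (sym t≈0))
          where
          t≈0 = theta-support (+ i ℤ.- + L) (≡.subst (N ℕ.≤_)
            (≡.trans (≡.cong ∣_∣ (mirror {i} {j} {L} eq)) (∣-∣-sym L i)) (far 2N≤L (ℕₚ.≰⇒> N≰j)))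

        -- The antidiagonal covers the closed interval [-n, n], one point more than `sumℤ n`.
        diag-sumℤ : ∀ n (f : ℤ → Carrier) → diag (n ℕ.+ n) (λ i _ → f (+ i ℤ.- + n)) ≈ sumℤ n f + f (+ n)
        diag-sumℤ zero f = sym (+-identityˡ _)
        diag-sumℤ (suc n) f = begin
          f -[1+ n ] + diag (n ℕ.+ suc n) (λ i _ → f (+ suc i ℤ.- + suc n))
            ≈⟨ +-congˡ (reflexive (≡.cong (λ m → diag m (λ i _ → f (+ suc i ℤ.- + suc n))) (ℕₚ.+-suc n n))) ⟩
          f -[1+ n ] + diag (suc (n ℕ.+ n)) (λ i _ → f (+ suc i ℤ.- + suc n))
            ≈⟨ +-congˡ (diag-last (n ℕ.+ n) (λ i _ → f (+ suc i ℤ.- + suc n))) ⟩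
          f -[1+ n ] + (diag (n ℕ.+ n) (λ i _ → f (+ suc i ℤ.- + suc n)) + f (+ suc (suc (n ℕ.+ n)) ℤ.- + suc n))
            ≈⟨ +-congˡ (+-cong (trans (diag-cong (n ℕ.+ n) (λ i j _ → reflexive (≡.cong f (suc-eq (+ i) (+ n))))) (diag-sumℤ n f))
                 (reflexive (≡.cong f (last-eq (+ n))))) ⟩
          f -[1+ n ] + (sumℤ n f + f (+ n) + f (+ suc n))
            ≈⟨ solve 4 (λ x s y z → x :+ (s :+ y :+ z) := s :+ (y :+ x) :+ z) refl _ _ _ _ ⟩
          sumℤ (suc n) f + f (+ suc n)
            ∎
          where
          suc-eq : ∀ i n → (ℤ.1ℤ ℤ.+ i) ℤ.- (ℤ.1ℤ ℤ.+ n) ≡ i ℤ.- n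
          suc-eq = solve-∀
          last-eq : ∀ n → (ℤ.1ℤ ℤ.+ (ℤ.1ℤ ℤ.+ (n ℤ.+ n))) ℤ.- (ℤ.1ℤ ℤ.+ n) ≡ ℤ.1ℤ ℤ.+ n
          last-eq = solve-∀

      triple-product : ∀ {L} → N ℕ.+ N ℕ.≤ L →
        progression ν (suc d) (suc d) L * (progression s (suc a) (suc d) L * progression s (suc c) (suc d) L)
          ≈ sumℤ N (theta (suc a) (suc c))
      triple-product {L} 2N≤L = begin
        pochhammer L * (progression s (suc a) (suc d) L * progression s (suc c) (suc d) L)
          ≈⟨ *-congˡ (triple-product-finite (suc a) (suc c) L L) ⟩
        pochhammer L * diag (L ℕ.+ L) (λ i j → gauss i j * t (+ i ℤ.- + L))
          ≈⟨ diag-*ˡ (L ℕ.+ L) _ _ ⟩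
        diag (L ℕ.+ L) (λ i j → pochhammer L * (gauss i j * t (+ i ℤ.- + L)))
          ≈⟨ diag-cong (L ℕ.+ L) (coefficient 2N≤L) ⟩
        diag (L ℕ.+ L) (λ i _ → t (+ i ℤ.- + L))
          ≈⟨ diag-sumℤ L t ⟩
        sumℤ L t + t (+ L)
          ≈⟨ trans (+-congˡ (theta-support (+ L) N≤L)) (+-identityʳ _) ⟩
        sumℤ L t
          ≈⟨ reflexive (≡.cong (λ m → sumℤ m t) (ℕₚ.m∸n+n≡m N≤L)) ⟨
        sumℤ (L ℕ.∸ N ℕ.+ N) t
          ≈⟨ sumℤ-extend (L ℕ.∸ N) N t theta-support ⟩
        sumℤ N t
          ∎
        where
        N≤L : N ℕ.≤ L
        N≤L = ℕₚ.≤-trans (ℕₚ.m≤m+n N N) 2N≤L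

    -- Euler's pentagonal number theorem in base q^d: the case x = -q^(2d), y = -q^d.
    pentagonal : ∀ d {m} → N ℕ.≤ m → progression ν (suc d) (suc d) m
      ≈ sumℤ N (λ k → ν ^ ∣ k ∣ * q ^ expo (suc d ℕ.+ suc d) (suc d) k)
    pentagonal d {m} N≤m = begin
      progression ν d′ d′ m
        ≈⟨ trans (progression-stable ν d′ d N≤m) (sym (progression-stable ν d′ d N≤3B)) ⟩
      progression ν d′ d′ (B ℕ.* 3)
        -- Modulo 3d the multiples of d form the classes d, 2d and 3d; the last is the Euler factor
        -- of a triple product in base q^(3d).
        ≈⟨ progression-thirds ν d′ d′ B ≡.refl ≡.refl ≡.refl ⟩
      progression ν d′ e B * progression ν (d′ ℕ.+ d′) e B * progression ν e e B
        ≈⟨ solve 3 (λ x y z → x :* y :* z := z :* (y :* x)) refl _ _ _ ⟩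
      progression ν e e B * (progression ν (d′ ℕ.+ d′) e B * progression ν d′ e B)
        ≈⟨ triple-product ν ν*ν≈1 (d ℕ.+ suc d) d ℕₚ.≤-refl ⟩
      sumℤ N (λ k → ν ^ ∣ k ∣ * q ^ expo (d′ ℕ.+ d′) d′ k)
        ∎
      where
      d′ = suc d
      e = d′ ℕ.+ d′ ℕ.+ d′
      B = N ℕ.+ N
      N≤3B : N ℕ.≤ B ℕ.* 3
      N≤3B = ℕₚ.≤-trans (ℕₚ.m≤m+n N N) (ℕₚ.m≤m*n B 3)

-- Exponents of the theta functions

-- Twice the exponent: without the halves of the triangular numbers, identities of exponents are
-- polynomial identities over ℤ.
expo₂ : ℤ → ℤ → ℤ → ℤ
expo₂ a c k = a ℤ.* (k ℤ.* k ℤ.+ k) ℤ.+ c ℤ.* (k ℤ.* k ℤ.- k)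

tri-double : ∀ n → + tri n ℤ.+ + tri n ≡ + n ℤ.* + n ℤ.+ + n
tri-double zero = ≡.refl
tri-double (suc n) = ≡.trans (regroup (+ n) (+ tri n)) (≡.trans (≡.cong (λ z → + 2 ℤ.* (ℤ.1ℤ ℤ.+ + n) ℤ.+ z) (tri-double n)) (square (+ n)))
  where
  regroup : ∀ n t → ((ℤ.1ℤ ℤ.+ n) ℤ.+ t) ℤ.+ ((ℤ.1ℤ ℤ.+ n) ℤ.+ t) ≡ + 2 ℤ.* (ℤ.1ℤ ℤ.+ n) ℤ.+ (t ℤ.+ t)
  regroup = solve-∀
  square : ∀ n → + 2 ℤ.* (ℤ.1ℤ ℤ.+ n) ℤ.+ (n ℤ.* n ℤ.+ n) ≡ (ℤ.1ℤ ℤ.+ n) ℤ.* (ℤ.1ℤ ℤ.+ n) ℤ.+ (ℤ.1ℤ ℤ.+ n)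
  square = solve-∀

tri⁺-double : ∀ k → + tri⁺ k ℤ.+ + tri⁺ k ≡ k ℤ.* k ℤ.+ k
tri⁺-double (+ n) = tri-double n
tri⁺-double -[1+ n ] = ≡.trans (tri-double n) (negate (+ n))
  where
  negate : ∀ n → n ℤ.* n ℤ.+ n ≡ (ℤ.- (ℤ.1ℤ ℤ.+ n)) ℤ.* (ℤ.- (ℤ.1ℤ ℤ.+ n)) ℤ.+ ℤ.- (ℤ.1ℤ ℤ.+ n)
  negate = solve-∀

tri⁻-double : ∀ k → + tri⁻ k ℤ.+ + tri⁻ k ≡ k ℤ.* k ℤ.- k
tri⁻-double (+ zero) = ≡.refl
tri⁻-double (+ suc n) = ≡.trans (tri-double n) (shift (+ n))
  where
  shift : ∀ n → n ℤ.* n ℤ.+ n ≡ (ℤ.1ℤ ℤ.+ n) ℤ.* (ℤ.1ℤ ℤ.+ n) ℤ.- (ℤ.1ℤ ℤ.+ n)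
  shift = solve-∀
tri⁻-double -[1+ n ] = ≡.trans (tri-double (suc n)) (negate (+ suc n))
  where
  negate : ∀ n → n ℤ.* n ℤ.+ n ≡ (ℤ.- n) ℤ.* (ℤ.- n) ℤ.- (ℤ.- n)
  negate = solve-∀

opaque
  unfolding expo

  expo-double : ∀ a c k → + expo a c k ℤ.+ + expo a c k ≡ expo₂ (+ a) (+ c) k
  expo-double a c k = ≡.trans (≡.cong (λ z → z ℤ.+ z) (≡.cong₂ ℤ._+_ (ℤₚ.pos-* a (tri⁺ k)) (ℤₚ.pos-* c (tri⁻ k))))
    (≡.trans (regroup (+ a) (+ c) (+ tri⁺ k) (+ tri⁻ k))
      (≡.cong₂ (λ x y → + a ℤ.* x ℤ.+ + c ℤ.* y) (tri⁺-double k) (tri⁻-double k)))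
    where
    regroup : ∀ a c x y → (a ℤ.* x ℤ.+ c ℤ.* y) ℤ.+ (a ℤ.* x ℤ.+ c ℤ.* y) ≡ a ℤ.* (x ℤ.+ x) ℤ.+ c ℤ.* (y ℤ.+ y)
    regroup = solve-∀

double-injective : ∀ m n → + m ℤ.+ + m ≡ + n ℤ.+ + n → m ≡ n
double-injective m n eq = ℕₚ.*-cancelˡ-≡ m n 2
  (≡.trans (twice m) (≡.trans (ℤₚ.+-injective eq) (≡.sym (twice n))))
  where
  twice : ∀ m → 2 ℕ.* m ≡ m ℕ.+ m
  twice m = ≡.cong (m ℕ.+_) (ℕₚ.+-identityʳ m)

expo-pair : ∀ a c a′ c′ x y r → let e = expo a c x ℕ.+ (expo a′ c′ y ℕ.+ r) in
  + e ℤ.+ + e ≡ expo₂ (+ a) (+ c) x ℤ.+ (expo₂ (+ a′) (+ c′) y ℤ.+ (+ r ℤ.+ + r))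
expo-pair a c a′ c′ x y r = ≡.trans (regroup (+ expo a c x) (+ expo a′ c′ y) (+ r))
  (≡.cong₂ (λ u v → u ℤ.+ (v ℤ.+ (+ r ℤ.+ + r))) (expo-double a c x) (expo-double a′ c′ y))
  where
  regroup : ∀ i j r → (i ℤ.+ (j ℤ.+ r)) ℤ.+ (i ℤ.+ (j ℤ.+ r)) ≡ (i ℤ.+ i) ℤ.+ ((j ℤ.+ j) ℤ.+ (r ℤ.+ r))
  regroup = solve-∀

expo-pair-eq : ∀ a c a′ c′ b d b′ d′ (x y z w : ℤ) r r′ →
  expo₂ (+ a) (+ c) x ℤ.+ (expo₂ (+ a′) (+ c′) y ℤ.+ (+ r ℤ.+ + r))
    ≡ expo₂ (+ b) (+ d) z ℤ.+ (expo₂ (+ b′) (+ d′) w ℤ.+ (+ r′ ℤ.+ + r′)) →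
  expo a c x ℕ.+ (expo a′ c′ y ℕ.+ r) ≡ expo b d z ℕ.+ (expo b′ d′ w ℕ.+ r′)
expo-pair-eq a c a′ c′ b d b′ d′ x y z w r r′ eq = double-injective _ _
  (≡.trans (expo-pair a c a′ c′ x y r) (≡.trans eq (≡.sym (expo-pair b d b′ d′ z w r′))))

-- With M = μ + 2, the theta functions are f(q^(2M-1), q), f(q^(2M+3), q^(4M-3)), f(q^(4M+3), q^(2M-3)),
-- f(-q^(4M), -q^(2M)) and f(-q^(2M-2), -q^2).
module Exponents (μ : ℕ) where

  μ₂ μ₄ : ℕ
  μ₂ = μ ℕ.+ μ
  μ₄ = μ₂ ℕ.+ μ₂

  e₀ e₁ e₂ e₃ e₄ : ℤ → ℕ
  e₀ = expo (3 ℕ.+ μ₂) 1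
  e₁ = expo (7 ℕ.+ μ₂) (5 ℕ.+ μ₄)
  e₂ = expo (11 ℕ.+ μ₄) (1 ℕ.+ μ₂)
  e₃ = expo ((4 ℕ.+ μ₂) ℕ.+ (4 ℕ.+ μ₂)) (4 ℕ.+ μ₂)
  e₄ = expo (2 ℕ.+ μ₂) 2

  private
    open ℤSolver
    :expo₂ : ∀ {n} → Polynomial n → Polynomial n → Polynomial n → Polynomial n
    :expo₂ a c k = a :* (k :* k :+ k) :+ c :* (k :* k :- k)
    :suc : ∀ {n} → Polynomial n → Polynomial n
    :suc x = con (+ 1) :+ x

  -- With X = 2Ma + M - 1 and Y = 6Mb + 3 - M for e₀ a + e₁ b, or Y = 6Mb + M + 3 for e₀ a + e₂ b + 1, the
  -- exponents are (3X² + Y²) / 12M up to a constant, and (X, Y) ↦ ((X - Y) / 2, ± (3X + Y) / 2) preserves the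
  -- form.  The parity of a + b decides whether the image comes from e₄ k + e₃ n or again from the left-hand side.
  rotation-even : ∀ b n → e₀ (ℤ.- b ℤ.+ (n ℤ.+ n)) ℕ.+ (e₁ b ℕ.+ 0) ≡ e₄ (n ℤ.- (b ℤ.+ b)) ℕ.+ (e₃ n ℕ.+ 0)
  rotation-even b n = expo-pair-eq (3 ℕ.+ μ₂) 1 (7 ℕ.+ μ₂) (5 ℕ.+ μ₄) (2 ℕ.+ μ₂) 2 ((4 ℕ.+ μ₂) ℕ.+ (4 ℕ.+ μ₂)) (4 ℕ.+ μ₂)
    (ℤ.- b ℤ.+ (n ℤ.+ n)) b (n ℤ.- (b ℤ.+ b)) n 0 0
    (solve 3 (λ m b n →
        :expo₂ (con (+ 3) :+ (m :+ m)) (con (+ 1)) (:- b :+ (n :+ n))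
          :+ (:expo₂ (con (+ 7) :+ (m :+ m)) (con (+ 5) :+ ((m :+ m) :+ (m :+ m))) b :+ con (+ 0))
      := :expo₂ (con (+ 2) :+ (m :+ m)) (con (+ 2)) (n :- (b :+ b))
          :+ (:expo₂ ((con (+ 4) :+ (m :+ m)) :+ (con (+ 4) :+ (m :+ m))) (con (+ 4) :+ (m :+ m)) n :+ con (+ 0)))
      ≡.refl (+ μ) b n)

  rotation-odd : ∀ b n → e₀ (ℤ.- b ℤ.+ ℤ.suc (n ℤ.+ n)) ℕ.+ (e₂ b ℕ.+ 1)
    ≡ e₄ (n ℤ.- (b ℤ.+ b)) ℕ.+ (e₃ (ℤ.- n ℤ.- ℤ.1ℤ) ℕ.+ 0)
  rotation-odd b n = expo-pair-eq (3 ℕ.+ μ₂) 1 (11 ℕ.+ μ₄) (1 ℕ.+ μ₂) (2 ℕ.+ μ₂) 2 ((4 ℕ.+ μ₂) ℕ.+ (4 ℕ.+ μ₂)) (4 ℕ.+ μ₂)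
    (ℤ.- b ℤ.+ ℤ.suc (n ℤ.+ n)) b (n ℤ.- (b ℤ.+ b)) (ℤ.- n ℤ.- ℤ.1ℤ) 1 0
    (solve 3 (λ m b n →
        :expo₂ (con (+ 3) :+ (m :+ m)) (con (+ 1)) (:- b :+ :suc (n :+ n))
          :+ (:expo₂ (con (+ 11) :+ ((m :+ m) :+ (m :+ m))) (con (+ 1) :+ (m :+ m)) b :+ con (+ 2))
      := :expo₂ (con (+ 2) :+ (m :+ m)) (con (+ 2)) (n :- (b :+ b))
          :+ (:expo₂ ((con (+ 4) :+ (m :+ m)) :+ (con (+ 4) :+ (m :+ m))) (con (+ 4) :+ (m :+ m)) (:- n :- con (+ 1)) :+ con (+ 0)))
      ≡.refl (+ μ) b n)

  -- Matches the terms of e₀ a + e₁ b with a + b odd to those of e₀ a + e₂ b + 1 with a + b even;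
  -- they have opposite signs and cancel.
  rotation-cancel : ∀ b n → let n′ = ℤ.- n ℤ.- ℤ.1ℤ; b′ = n′ ℤ.+ b in
    e₀ (ℤ.- b ℤ.+ ℤ.suc (n ℤ.+ n)) ℕ.+ (e₁ b ℕ.+ 0) ≡ e₀ (ℤ.- b′ ℤ.+ (n′ ℤ.+ n′)) ℕ.+ (e₂ b′ ℕ.+ 1)
  rotation-cancel b n = expo-pair-eq (3 ℕ.+ μ₂) 1 (7 ℕ.+ μ₂) (5 ℕ.+ μ₄) (3 ℕ.+ μ₂) 1 (11 ℕ.+ μ₄) (1 ℕ.+ μ₂)
    (ℤ.- b ℤ.+ ℤ.suc (n ℤ.+ n)) b (ℤ.- b′ ℤ.+ (n′ ℤ.+ n′)) b′ 0 1
    (solve 3 (λ m b n → let n′ = :- n :- con (+ 1); b′ = n′ :+ b in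
        :expo₂ (con (+ 3) :+ (m :+ m)) (con (+ 1)) (:- b :+ :suc (n :+ n))
          :+ (:expo₂ (con (+ 7) :+ (m :+ m)) (con (+ 5) :+ ((m :+ m) :+ (m :+ m))) b :+ con (+ 0))
      := :expo₂ (con (+ 3) :+ (m :+ m)) (con (+ 1)) (:- b′ :+ (n′ :+ n′))
          :+ (:expo₂ (con (+ 11) :+ ((m :+ m) :+ (m :+ m))) (con (+ 1) :+ (m :+ m)) b′ :+ con (+ 2)))
      ≡.refl (+ μ) b n)
    where
    n′ = ℤ.- n ℤ.- ℤ.1ℤ
    b′ = n′ ℤ.+ b

-- Products of theta functions

module Products {c ℓ} (R : CommutativeRing c ℓ) where

  open CommutativeRing R hiding (zero)
  open Sums R
  open import Relation.Binary.Reasoning.Setoid setoid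

  sumℤ-* : ∀ n f g → sumℤ n f * sumℤ n g ≈ sumℤ n (λ j → sumℤ n (λ i → f i * g j))
  sumℤ-* n f g = trans (sumℤ-*ˡ n _ g) (sumℤ-cong n (λ j → sumℤ-*ʳ n (g j) f))

  module _ (N : ℕ) (f g : ℤ → Carrier) (f-supp : SupportedIn N f) (g-supp : SupportedIn N g) where

    private
      B = N ℕ.+ N

      N≤B : N ℕ.≤ B
      N≤B = ℕₚ.m≤m+n N N

      away : ∀ x y {k} → k ≡ x ℤ.+ y → ∣ y ∣ ℕ.≤ N → B ℕ.≤ ∣ k ∣ → N ℕ.≤ ∣ x ∣
      away x y ≡.refl y≤N B≤k = ℕₚ.+-cancelʳ-≤ N N ∣ x ∣
        (ℕₚ.≤-trans B≤k (ℕₚ.≤-trans (ℤₚ.∣i+j∣≤∣i∣+∣j∣ x y) (ℕₚ.+-monoʳ-≤ ∣ x ∣ y≤N)))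

      fg-supp : ∀ n (x : ℤ → ℤ) → (∀ k → ∣ n ∣ ℕ.< N → B ℕ.≤ ∣ k ∣ → N ℕ.≤ ∣ x k ∣) →
        SupportedIn B (λ k → f (x k) * g n)
      fg-supp n x far k B≤k with N ℕ.≤? ∣ n ∣
      ... | yes N≤n = trans (*-congˡ (g-supp n N≤n)) (zeroʳ _)
      ... | no N≰n = trans (*-congʳ (f-supp (x k) (far k (ℕₚ.≰⇒> N≰n) B≤k))) (zeroˡ _)

      ∣suc∣≤ : ∀ n → ∣ n ∣ ℕ.< N → ∣ ℤ.suc n ∣ ℕ.≤ N
      ∣suc∣≤ n n<N = ℕₚ.≤-trans (ℤₚ.∣i+j∣≤∣i∣+∣j∣ ℤ.1ℤ n) n<N

      ∣pred∣≤ : ∀ n → ∣ n ∣ ℕ.< N → ∣ ℤ.pred n ∣ ℕ.≤ N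
      ∣pred∣≤ n n<N = ℕₚ.≤-trans (ℤₚ.∣i+j∣≤∣i∣+∣j∣ (ℤ.- ℤ.1ℤ) n) n<N

      ∣neg∣≤ : ∀ n → ∣ n ∣ ℕ.≤ N → ∣ ℤ.- n ∣ ℕ.≤ N
      ∣neg∣≤ n = ≡.subst (ℕ._≤ N) (≡.sym (ℤₚ.∣-i∣≡∣i∣ n))

      ∣k∣≤∣k+k∣ : ∀ k → ∣ k ∣ ℕ.≤ ∣ k ℤ.+ k ∣
      ∣k∣≤∣k+k∣ (+ n) = ℕₚ.m≤m+n n n
      ∣k∣≤∣k+k∣ -[1+ n ] = ℕ.s≤s (ℕₚ.m≤n⇒m≤1+n (ℕₚ.m≤m+n n n))

    -- The inner index becomes i + j and is split by parity. With i and j below N in absolute value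
    -- this sum can approach 2N, hence the radius.
    product-skew : sumℤ B f * sumℤ B g ≈
      sumℤ B (λ j → sumℤ B (λ n → f (ℤ.- j ℤ.+ (n ℤ.+ n)) * g j))
      + sumℤ B (λ j → sumℤ B (λ n → f (ℤ.- j ℤ.+ ℤ.suc (n ℤ.+ n)) * g j))
    product-skew = begin
      sumℤ B f * sumℤ B g
        ≈⟨ sumℤ-* B f g ⟩
      sumℤ B (λ j → sumℤ B (λ i → f i * g j))
        ≈⟨ sumℤ-cong B (λ j → sym (sumℤ-translate (ℤ.- j) B (λ i → f i * g j) (supp₀ j) (supp₁ j))) ⟩
      sumℤ B (λ j → sumℤ B (λ i → f (ℤ.- j ℤ.+ i) * g j))
        ≈⟨ sumℤ-cong B (λ j → sumℤ-parity B (λ i → f (ℤ.- j ℤ.+ i) * g j) (supp₁ j)) ⟩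
      sumℤ B (λ j → sumℤ B (λ n → f (ℤ.- j ℤ.+ (n ℤ.+ n)) * g j)
        + sumℤ B (λ n → f (ℤ.- j ℤ.+ ℤ.suc (n ℤ.+ n)) * g j))
        ≈⟨ sumℤ-+ B (λ j → sumℤ B (λ n → f (ℤ.- j ℤ.+ (n ℤ.+ n)) * g j))
             (λ j → sumℤ B (λ n → f (ℤ.- j ℤ.+ ℤ.suc (n ℤ.+ n)) * g j)) ⟩
      sumℤ B (λ j → sumℤ B (λ n → f (ℤ.- j ℤ.+ (n ℤ.+ n)) * g j))
        + sumℤ B (λ j → sumℤ B (λ n → f (ℤ.- j ℤ.+ ℤ.suc (n ℤ.+ n)) * g j))
        ∎
      where
      supp₀ : ∀ j → SupportedIn B (λ i → f i * g j)
      supp₀ j = fg-supp j (λ k → k) (λ k _ B≤k → ℕₚ.≤-trans N≤B B≤k)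
      supp₁ : ∀ j → SupportedIn B (λ i → f (ℤ.- j ℤ.+ i) * g j)
      supp₁ j = fg-supp j (λ k → ℤ.- j ℤ.+ k) (λ k j<N → away (ℤ.- j ℤ.+ k) j (eq j k) (ℕₚ.<⇒≤ j<N))
        where
        eq : ∀ j k → k ≡ (ℤ.- j ℤ.+ k) ℤ.+ j
        eq = solve-∀

    -- The split is by the parity of n - k. In the odd half, shifting j by n turns n - (2j + 1) into
    -- (-n - 1) - 2j, the even form with n flipped, as `rotation-odd` requires.
    product-split : sumℤ B f * sumℤ B g ≈
      sumℤ B (λ n → sumℤ B (λ j → f (n ℤ.- (j ℤ.+ j)) * g n))
      + sumℤ B (λ n → sumℤ B (λ j → f (ℤ.- n ℤ.- ℤ.1ℤ ℤ.- (j ℤ.+ j)) * g n))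
    product-split = begin
      sumℤ B f * sumℤ B g
        ≈⟨ sumℤ-* B f g ⟩
      sumℤ B (λ n → sumℤ B (λ k → f k * g n))
        ≈⟨ sumℤ-cong B inner ⟩
      sumℤ B (λ n → sumℤ B (λ j → f (n ℤ.- (j ℤ.+ j)) * g n)
        + sumℤ B (λ j → f (ℤ.- n ℤ.- ℤ.1ℤ ℤ.- (j ℤ.+ j)) * g n))
        ≈⟨ sumℤ-+ B (λ n → sumℤ B (λ j → f (n ℤ.- (j ℤ.+ j)) * g n))
             (λ n → sumℤ B (λ j → f (ℤ.- n ℤ.- ℤ.1ℤ ℤ.- (j ℤ.+ j)) * g n)) ⟩
      sumℤ B (λ n → sumℤ B (λ j → f (n ℤ.- (j ℤ.+ j)) * g n))
        + sumℤ B (λ n → sumℤ B (λ j → f (ℤ.- n ℤ.- ℤ.1ℤ ℤ.- (j ℤ.+ j)) * g n))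
        ∎
      where
      inner : ∀ n → sumℤ B (λ k → f k * g n) ≈ sumℤ B (λ j → f (n ℤ.- (j ℤ.+ j)) * g n)
        + sumℤ B (λ j → f (ℤ.- n ℤ.- ℤ.1ℤ ℤ.- (j ℤ.+ j)) * g n)
      inner n = begin
        sumℤ B h
          ≈⟨ sumℤ-reflect n B h supp₀ supp₁ ⟨
        sumℤ B (λ k → h (n ℤ.- k))
          ≈⟨ sumℤ-parity B (λ k → h (n ℤ.- k)) supp₂ ⟩
        sumℤ B (λ j → h (n ℤ.- (j ℤ.+ j))) + sumℤ B (λ j → h (n ℤ.- ℤ.suc (j ℤ.+ j)))
          ≈⟨ +-congˡ (sumℤ-translate n B (λ j → h (n ℤ.- ℤ.suc (j ℤ.+ j))) supp₃ supp₄) ⟨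
        sumℤ B (λ j → h (n ℤ.- (j ℤ.+ j))) + sumℤ B (λ j → h (n ℤ.- ℤ.suc ((n ℤ.+ j) ℤ.+ (n ℤ.+ j))))
          ≈⟨ +-congˡ (sumℤ-cong B (λ j → reflexive (≡.cong h (translated n j)))) ⟩
        sumℤ B (λ j → h (n ℤ.- (j ℤ.+ j))) + sumℤ B (λ j → h (ℤ.- n ℤ.- ℤ.1ℤ ℤ.- (j ℤ.+ j)))
          ∎
        where
        h : ℤ → Carrier
        h k = f k * g n
        translated : ∀ n j → n ℤ.- (ℤ.1ℤ ℤ.+ ((n ℤ.+ j) ℤ.+ (n ℤ.+ j))) ≡ ℤ.- n ℤ.- ℤ.1ℤ ℤ.- (j ℤ.+ j)
        translated = solve-∀
        supp₀ : SupportedIn B h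
        supp₀ = fg-supp n (λ k → k) (λ k _ B≤k → ℕₚ.≤-trans N≤B B≤k)
        supp₁ : SupportedIn B (λ k → h (ℤ.suc n ℤ.+ k))
        supp₁ = fg-supp n (λ k → ℤ.suc n ℤ.+ k)
          (λ k n<N → away (ℤ.suc n ℤ.+ k) (ℤ.- ℤ.suc n) (eq (ℤ.suc n) k) (∣neg∣≤ (ℤ.suc n) (∣suc∣≤ n n<N)))
          where
          eq : ∀ n k → k ≡ (n ℤ.+ k) ℤ.+ ℤ.- n
          eq = solve-∀
        flip-away : ∀ x y {k} → k ≡ y ℤ.- x → ∣ y ∣ ℕ.≤ N → B ℕ.≤ ∣ k ∣ → N ℕ.≤ ∣ x ∣
        flip-away x y eq y≤N B≤k = ≡.subst (N ℕ.≤_) (ℤₚ.∣-i∣≡∣i∣ x)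
          (away (ℤ.- x) y (≡.trans eq (ℤₚ.+-comm y (ℤ.- x))) y≤N B≤k)
        supp₂ : SupportedIn B (λ k → h (n ℤ.- k))
        supp₂ = fg-supp n (λ k → n ℤ.- k) (λ k n<N → flip-away _ n (eq n k) (ℕₚ.<⇒≤ n<N))
          where
          eq : ∀ n k → k ≡ n ℤ.- (n ℤ.- k)
          eq = solve-∀
        supp₃ : SupportedIn B (λ j → h (n ℤ.- ℤ.suc (j ℤ.+ j)))
        supp₃ = fg-supp n (λ j → n ℤ.- ℤ.suc (j ℤ.+ j))
          (λ j n<N B≤j → flip-away _ (ℤ.pred n) (eq n j) (∣pred∣≤ n n<N) (ℕₚ.≤-trans B≤j (∣k∣≤∣k+k∣ j)))
          where
          eq : ∀ n j → j ℤ.+ j ≡ (ℤ.- ℤ.1ℤ ℤ.+ n) ℤ.- (n ℤ.- (ℤ.1ℤ ℤ.+ (j ℤ.+ j)))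
          eq = solve-∀
        supp₄ : SupportedIn B (λ j → h (n ℤ.- ℤ.suc ((n ℤ.+ j) ℤ.+ (n ℤ.+ j))))
        supp₄ = fg-supp n (λ j → n ℤ.- ℤ.suc ((n ℤ.+ j) ℤ.+ (n ℤ.+ j)))
          (λ j n<N B≤j → flip-away _ (ℤ.- ℤ.suc n) (eq n j) (∣neg∣≤ (ℤ.suc n) (∣suc∣≤ n n<N)) (ℕₚ.≤-trans B≤j (∣k∣≤∣k+k∣ j)))
          where
          eq : ∀ n j → j ℤ.+ j ≡ ℤ.- (ℤ.1ℤ ℤ.+ n) ℤ.- (n ℤ.- (ℤ.1ℤ ℤ.+ ((n ℤ.+ j) ℤ.+ (n ℤ.+ j))))
          eq = solve-∀

-- The quintuple product identity and the formula for G - q F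

module Quintuple {c ℓ} (R : CommutativeRing c ℓ) (q : CommutativeRing.Carrier R) (μ : ℕ) where

  open CommutativeRing R hiding (zero)
  open Sums R
  open Products R
  open Nilpotent R q
  open Exponents μ
  open import Relation.Binary.Reasoning.Setoid setoid
  open SemiringSolver commutativeSemiring using (solve; _:=_; _:+_; _:*_; con)

  sign : ℤ → Carrier
  sign k = ν ^ ∣ k ∣

  private
    sign-suc : ∀ k → sign (ℤ.suc k) ≈ ν * sign k
    sign-suc (+ n) = refl
    sign-suc -[1+ n ] = begin
      sign (ℤ.suc -[1+ n ])      ≈⟨ reflexive (≡.cong sign (suc-neg n)) ⟩
      sign (ℤ.- (+ n))           ≈⟨ ^-congʳ ν (ℤₚ.∣-i∣≡∣i∣ (+ n)) ⟩
      ν ^ n                      ≈⟨ *-identityˡ _ ⟨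
      1# * ν ^ n                 ≈⟨ *-congʳ ν*ν≈1 ⟨
      ν * ν * ν ^ n              ≈⟨ *-assoc _ _ _ ⟩
      ν * (ν * ν ^ n)            ∎

    sign-neg : ∀ k → sign (ℤ.- k) ≈ sign k
    sign-neg k = ^-congʳ ν (ℤₚ.∣-i∣≡∣i∣ k)

    sign-+⁺ : ∀ n k → sign (+ n ℤ.+ k) ≈ sign (+ n) * sign k
    sign-+⁺ zero k = trans (reflexive (≡.cong sign (ℤₚ.+-identityˡ k))) (sym (*-identityˡ _))
    sign-+⁺ (suc n) k = begin
      sign (+ suc n ℤ.+ k)           ≈⟨ reflexive (≡.cong sign (ℤₚ.+-assoc ℤ.1ℤ (+ n) k)) ⟩
      sign (ℤ.suc (+ n ℤ.+ k))       ≈⟨ sign-suc (+ n ℤ.+ k) ⟩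
      ν * sign (+ n ℤ.+ k)           ≈⟨ *-congˡ (sign-+⁺ n k) ⟩
      ν * (sign (+ n) * sign k)      ≈⟨ *-assoc _ _ _ ⟨
      sign (+ suc n) * sign k        ∎

    sign-+ : ∀ j k → sign (j ℤ.+ k) ≈ sign j * sign k
    sign-+ (+ n) k = sign-+⁺ n k
    sign-+ -[1+ n ] k = begin
      sign (-[1+ n ] ℤ.+ k)                ≈⟨ sign-neg (-[1+ n ] ℤ.+ k) ⟨
      sign (ℤ.- (-[1+ n ] ℤ.+ k))          ≈⟨ reflexive (≡.cong sign (ℤₚ.neg-distrib-+ -[1+ n ] k)) ⟩
      sign (+ suc n ℤ.+ ℤ.- k)             ≈⟨ sign-+⁺ (suc n) (ℤ.- k) ⟩
      sign (+ suc n) * sign (ℤ.- k)        ≈⟨ *-congˡ (sign-neg k) ⟩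
      sign -[1+ n ] * sign k               ∎

    sign-square : ∀ k → sign k * sign k ≈ 1#
    sign-square k = go ∣ k ∣
      where
      go : ∀ n → ν ^ n * ν ^ n ≈ 1#
      go zero = *-identityˡ 1#
      go (suc n) = begin
        ν * ν ^ n * (ν * ν ^ n)        ≈⟨ solve 2 (λ x y → x :* y :* (x :* y) := x :* x :* (y :* y)) refl ν (ν ^ n) ⟩
        ν * ν * (ν ^ n * ν ^ n)        ≈⟨ *-cong ν*ν≈1 (go n) ⟩
        1# * 1#                        ≈⟨ *-identityˡ 1# ⟩
        1#                             ∎

    sign-even-shift : ∀ n j → sign (n ℤ.- (j ℤ.+ j)) ≈ sign n
    sign-even-shift n j = begin
      sign (n ℤ.- (j ℤ.+ j))               ≈⟨ sign-+ n _ ⟩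
      sign n * sign (ℤ.- (j ℤ.+ j))        ≈⟨ *-congˡ (trans (sign-neg (j ℤ.+ j)) (trans (sign-+ j j) (sign-square j))) ⟩
      sign n * 1#                          ≈⟨ *-identityʳ _ ⟩
      sign n                               ∎

  t₀ t₁ t₂ t₃ t₄ : ℤ → Carrier
  t₀ k = q ^ e₀ k
  t₁ k = q ^ e₁ k
  t₂ k = q ^ e₂ k
  t₃ k = sign k * q ^ e₃ k
  t₄ k = sign k * q ^ e₄ k

  private
    collect : ∀ m n → q ^ m * q ^ n ≈ q ^ (m ℕ.+ (n ℕ.+ 0))
    collect m n = trans (sym (^-homo-* q m n)) (q^ (≡.cong (m ℕ.+_) (≡.sym (ℕₚ.+-identityʳ n))))

    collect-q : ∀ m n → q ^ m * (q * q ^ n) ≈ q ^ (m ℕ.+ (n ℕ.+ 1))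
    collect-q m n = trans (sym (^-homo-* q m (suc n))) (q^ (≡.cong (m ℕ.+_) (≡.sym (ℕₚ.+-comm n 1))))

    even-term : ∀ n b → t₀ (ℤ.- b ℤ.+ (n ℤ.+ n)) * t₁ b ≈ t₄ (n ℤ.- (b ℤ.+ b)) * t₃ n
    even-term n b = begin
      t₀ (ℤ.- b ℤ.+ (n ℤ.+ n)) * t₁ b      ≈⟨ collect (e₀ (ℤ.- b ℤ.+ (n ℤ.+ n))) (e₁ b) ⟩
      _                                    ≈⟨ q^ (rotation-even b n) ⟩
      _                                    ≈⟨ collect (e₄ k) (e₃ n) ⟨
      q ^ e₄ k * q ^ e₃ n                  ≈⟨ *-identityˡ _ ⟨
      1# * (q ^ e₄ k * q ^ e₃ n)           ≈⟨ *-congʳ (trans (*-congʳ (sign-even-shift n b)) (sign-square n)) ⟨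
      sign k * sign n * (q ^ e₄ k * q ^ e₃ n)
        ≈⟨ solve 4 (λ x y z w → x :* y :* (z :* w) := x :* z :* (y :* w)) refl _ _ _ _ ⟩
      t₄ k * t₃ n                          ∎
      where k = n ℤ.- (b ℤ.+ b)

    -- The indices n and -n - 1 have opposite parity, which produces the sign of the second product.
    odd-term : ∀ n b → ν * (t₀ (ℤ.- b ℤ.+ ℤ.suc (n ℤ.+ n)) * (q * t₂ b)) ≈ t₄ (n ℤ.- (b ℤ.+ b)) * t₃ (ℤ.- n ℤ.- ℤ.1ℤ)
    odd-term n b = begin
      ν * (t₀ (ℤ.- b ℤ.+ ℤ.suc (n ℤ.+ n)) * (q * t₂ b))
        ≈⟨ *-congˡ (collect-q (e₀ (ℤ.- b ℤ.+ ℤ.suc (n ℤ.+ n))) (e₂ b)) ⟩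
      _
        ≈⟨ *-congˡ (q^ (rotation-odd b n)) ⟩
      _
        ≈⟨ *-congˡ (collect (e₄ k) (e₃ n′)) ⟨
      ν * (q ^ e₄ k * q ^ e₃ n′)
        ≈⟨ *-congʳ signs ⟨
      sign k * sign n′ * (q ^ e₄ k * q ^ e₃ n′)
        ≈⟨ solve 4 (λ x y z w → x :* y :* (z :* w) := x :* z :* (y :* w)) refl _ _ _ _ ⟩
      t₄ k * t₃ n′
        ∎
      where
      k = n ℤ.- (b ℤ.+ b)
      n′ = ℤ.- n ℤ.- ℤ.1ℤ
      flip-eq : ∀ n → ℤ.- n ℤ.- ℤ.1ℤ ≡ ℤ.- (ℤ.1ℤ ℤ.+ n)
      flip-eq = solve-∀
      signs : sign k * sign n′ ≈ ν
      signs = begin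
        sign k * sign n′           ≈⟨ *-cong (sign-even-shift n b) (trans (reflexive (≡.cong sign (flip-eq n))) (trans (sign-neg (ℤ.suc n)) (sign-suc n))) ⟩
        sign n * (ν * sign n)      ≈⟨ solve 2 (λ x y → x :* (y :* x) := y :* (x :* x)) refl (sign n) ν ⟩
        ν * (sign n * sign n)      ≈⟨ trans (*-congˡ (sign-square n)) (*-identityʳ ν) ⟩
        ν                          ∎

    cancel-term : ∀ n b → let n′ = flip-ℤ n; b′ = n′ ℤ.+ b in
      t₀ (ℤ.- b ℤ.+ ℤ.suc (n ℤ.+ n)) * t₁ b ≈ t₀ (ℤ.- b′ ℤ.+ (n′ ℤ.+ n′)) * (q * t₂ b′)
    cancel-term n b rewrite flip-ℤ≡ n = begin
      t₀ (ℤ.- b ℤ.+ ℤ.suc (n ℤ.+ n)) * t₁ b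
        ≈⟨ collect (e₀ (ℤ.- b ℤ.+ ℤ.suc (n ℤ.+ n))) (e₁ b) ⟩
      _
        ≈⟨ q^ (rotation-cancel b n) ⟩
      _
        ≈⟨ collect-q (e₀ (ℤ.- b′ ℤ.+ (n′ ℤ.+ n′))) (e₂ b′) ⟨
      t₀ (ℤ.- b′ ℤ.+ (n′ ℤ.+ n′)) * (q * t₂ b′)
        ∎
      where
      n′ = ℤ.- n ℤ.- ℤ.1ℤ
      b′ = n′ ℤ.+ b

  module _ (N : ℕ) (q^N≈0 : q ^ N ≈ 0#) where

    open Truncated N q^N≈0

    private
      B = N ℕ.+ N

      power-support : ∀ a c → SupportedIn N (λ k → q ^ expo (suc a) (suc c) k)
      power-support a c k N≤k = q^-vanishes (ℕₚ.≤-trans N≤k (∣k∣≤expo a c k))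

      qt₂ : ℤ → Carrier
      qt₂ k = q * t₂ k

      supp₀ : SupportedIn N t₀
      supp₀ = power-support (2 ℕ.+ μ₂) 0
      supp₁ : SupportedIn N t₁
      supp₁ = power-support (6 ℕ.+ μ₂) (4 ℕ.+ μ₄)
      supp₂ : SupportedIn N qt₂
      supp₂ k N≤k = trans (*-congˡ (power-support (10 ℕ.+ μ₄) μ₂ k N≤k)) (zeroʳ q)
      supp₃ : SupportedIn N t₃
      supp₃ = theta-support ν ν*ν≈1 (3 ℕ.+ μ₂ ℕ.+ (4 ℕ.+ μ₂)) (3 ℕ.+ μ₂)
      supp₄ : SupportedIn N t₄
      supp₄ = theta-support ν ν*ν≈1 (1 ℕ.+ μ₂) 1

      widen : ∀ {f} → SupportedIn N f → sumℤ N f ≈ sumℤ B f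
      widen {f} supp = sym (sumℤ-extend N N f supp)

    -- Both products on the left are split by the parity of the index sum. The odd half of the first
    -- cancels the even half of the second; the other two are the halves of the right-hand side
    -- given by `product-split`.
    theta-products : sumℤ N t₀ * (sumℤ N t₁ + ν * (q * sumℤ N t₂)) ≈ sumℤ N t₄ * sumℤ N t₃
    theta-products = begin
      sumℤ N t₀ * (sumℤ N t₁ + ν * (q * sumℤ N t₂))
        ≈⟨ *-congˡ (+-congˡ (*-congˡ (sumℤ-*ˡ N q t₂))) ⟩
      sumℤ N t₀ * (sumℤ N t₁ + ν * sumℤ N qt₂)
        ≈⟨ *-cong (widen supp₀) (+-cong (widen supp₁) (*-congˡ (widen supp₂))) ⟩
      sumℤ B t₀ * (sumℤ B t₁ + ν * sumℤ B qt₂)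
        ≈⟨ solve 4 (λ x y n z → x :* (y :+ n :* z) := x :* y :+ n :* (x :* z)) refl _ _ _ _ ⟩
      sumℤ B t₀ * sumℤ B t₁ + ν * (sumℤ B t₀ * sumℤ B qt₂)
        ≈⟨ +-cong (product-skew N t₀ t₁ supp₀ supp₁) (*-congˡ (product-skew N t₀ qt₂ supp₀ supp₂)) ⟩
      (even₁ + odd₁) + ν * (even₂ + odd₂)
        ≈⟨ +-congʳ (+-congˡ odd₁≈even₂) ⟩
      (even₁ + even₂) + ν * (even₂ + odd₂)
        ≈⟨ solve 4 (λ x y n z → (x :+ y) :+ n :* (y :+ z) := (x :+ n :* z) :+ (y :+ n :* y)) refl _ _ _ _ ⟩
      (even₁ + ν * odd₂) + (even₂ + ν * even₂)
        ≈⟨ trans (+-congˡ (x+νx≈0 even₂)) (+-identityʳ _) ⟩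
      even₁ + ν * odd₂
        ≈⟨ +-cong even₁≈ odd₂≈ ⟩
      sumℤ B (λ n → sumℤ B (λ b → t₄ (n ℤ.- (b ℤ.+ b)) * t₃ n))
        + sumℤ B (λ n → sumℤ B (λ b → t₄ (ℤ.- n ℤ.- ℤ.1ℤ ℤ.- (b ℤ.+ b)) * t₃ n))
        ≈⟨ product-split N t₄ t₃ supp₄ supp₃ ⟨
      sumℤ B t₄ * sumℤ B t₃
        ≈⟨ *-cong (widen supp₄) (widen supp₃) ⟨
      sumℤ N t₄ * sumℤ N t₃
        ∎
      where
      even₁ = sumℤ B (λ b → sumℤ B (λ n → t₀ (ℤ.- b ℤ.+ (n ℤ.+ n)) * t₁ b))
      odd₁ = sumℤ B (λ b → sumℤ B (λ n → t₀ (ℤ.- b ℤ.+ ℤ.suc (n ℤ.+ n)) * t₁ b))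
      even₂ = sumℤ B (λ b → sumℤ B (λ n → t₀ (ℤ.- b ℤ.+ (n ℤ.+ n)) * qt₂ b))
      odd₂ = sumℤ B (λ b → sumℤ B (λ n → t₀ (ℤ.- b ℤ.+ ℤ.suc (n ℤ.+ n)) * qt₂ b))

      even₁≈ : even₁ ≈ sumℤ B (λ n → sumℤ B (λ b → t₄ (n ℤ.- (b ℤ.+ b)) * t₃ n))
      even₁≈ = trans (sumℤ-swap B B (λ b n → t₀ (ℤ.- b ℤ.+ (n ℤ.+ n)) * t₁ b))
        (sumℤ-cong B (λ n → sumℤ-cong B (λ b → even-term n b)))

      odd₂≈ : ν * odd₂ ≈ sumℤ B (λ n → sumℤ B (λ b → t₄ (ℤ.- n ℤ.- ℤ.1ℤ ℤ.- (b ℤ.+ b)) * t₃ n))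
      odd₂≈ = begin
        ν * odd₂
          ≈⟨ *-congˡ (sumℤ-swap B B (λ b n → t₀ (ℤ.- b ℤ.+ ℤ.suc (n ℤ.+ n)) * qt₂ b)) ⟩
        ν * sumℤ B (λ n → sumℤ B (λ b → t₀ (ℤ.- b ℤ.+ ℤ.suc (n ℤ.+ n)) * qt₂ b))
          ≈⟨ trans (sumℤ-*ˡ B ν (λ n → sumℤ B (λ b → t₀ (ℤ.- b ℤ.+ ℤ.suc (n ℤ.+ n)) * qt₂ b)))
               (sumℤ-cong B (λ n → sumℤ-*ˡ B ν (λ b → t₀ (ℤ.- b ℤ.+ ℤ.suc (n ℤ.+ n)) * qt₂ b))) ⟩
        sumℤ B (λ n → sumℤ B (λ b → ν * (t₀ (ℤ.- b ℤ.+ ℤ.suc (n ℤ.+ n)) * qt₂ b)))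
          ≈⟨ sumℤ-cong B (λ n → sumℤ-cong B (λ b → odd-term n b)) ⟩
        sumℤ B (λ n → sumℤ B (λ b → t₄ (n ℤ.- (b ℤ.+ b)) * t₃ (ℤ.- n ℤ.- ℤ.1ℤ)))
          ≈⟨ sumℤ-cong B (λ n → reflexive (≡.cong₂ (λ i j → sumℤ B (λ b → t₄ (i ℤ.- (b ℤ.+ b)) * t₃ j)) (flip-flip n) (≡.sym (flip-ℤ≡ n)))) ⟩
        sumℤ B (λ n → g (flip-ℤ n))
          ≈⟨ sumℤ-flip B g ⟩
        sumℤ B g
          ∎
        where
        g : ℤ → Carrier
        g n = sumℤ B (λ b → t₄ (ℤ.- n ℤ.- ℤ.1ℤ ℤ.- (b ℤ.+ b)) * t₃ n)
        involution : ∀ n → n ≡ ℤ.- (ℤ.- n ℤ.- ℤ.1ℤ) ℤ.- ℤ.1ℤ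
        involution = solve-∀
        flip-flip : ∀ n → n ≡ ℤ.- flip-ℤ n ℤ.- ℤ.1ℤ
        flip-flip n = ≡.trans (involution n) (≡.cong (λ z → ℤ.- z ℤ.- ℤ.1ℤ) (≡.sym (flip-ℤ≡ n)))

      odd₁≈even₂ : odd₁ ≈ even₂
      odd₁≈even₂ = begin
        odd₁
          ≈⟨ sumℤ-swap B B (λ b n → t₀ (ℤ.- b ℤ.+ ℤ.suc (n ℤ.+ n)) * t₁ b) ⟩
        sumℤ B (λ n → sumℤ B (λ b → t₀ (ℤ.- b ℤ.+ ℤ.suc (n ℤ.+ n)) * t₁ b))
          ≈⟨ sumℤ-cong B (λ n → sumℤ-cong B (λ b → cancel-term n b)) ⟩
        sumℤ B (λ n → sumℤ B (λ b → h (flip-ℤ n) (flip-ℤ n ℤ.+ b)))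
          ≈⟨ sumℤ-cong B (λ n → sumℤ-translate (flip-ℤ n) B (h (flip-ℤ n)) (h-supp n) (h-supp′ n)) ⟩
        sumℤ B (λ n → sumℤ B (h (flip-ℤ n)))
          ≈⟨ sumℤ-flip B (λ n → sumℤ B (h n)) ⟩
        sumℤ B (λ n → sumℤ B (h n))
          ≈⟨ sumℤ-swap B B h ⟩
        even₂
          ∎
        where
        h : ℤ → ℤ → Carrier
        h n b = t₀ (ℤ.- b ℤ.+ (n ℤ.+ n)) * qt₂ b
        h-supp : ∀ n → SupportedIn B (h (flip-ℤ n))
        h-supp n b B≤b = trans (*-congˡ (supp₂ b (ℕₚ.≤-trans (ℕₚ.m≤m+n N N) B≤b))) (zeroʳ _)
        h-supp′ : ∀ n → SupportedIn B (λ b → h (flip-ℤ n) (flip-ℤ n ℤ.+ b))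
        -- By `cancel-term` the translated term equals the original one, whose factor `t₁ b`
        -- vanishes.
        h-supp′ n b B≤b = trans (sym (cancel-term n b)) (trans (*-congˡ (supp₁ b (ℕₚ.≤-trans (ℕₚ.m≤m+n N N) B≤b))) (zeroʳ _))

  -- The moduli 2M and 6M.
  D₂ D : ℕ
  D₂ = 4 ℕ.+ μ₂
  D = 12 ℕ.+ (μ₄ ℕ.+ μ₂)

  private
    φ : ℕ → ℕ → Carrier
    φ e i = factor 1# (e ℕ.+ D ℕ.* i)

  -- The factors of G and F with exponents between 6Mi and 6M(i + 1). For M = 4 and M = 5 the
  -- residues are in increasing order, as in the product over one period.
  block⁺ block⁻ : ℕ → Carrier
  block⁺ i = φ 1 i * φ (3 ℕ.+ μ₂) i * φ (5 ℕ.+ μ₂) i * φ (7 ℕ.+ μ₂) i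
    * φ (5 ℕ.+ μ₄) i * φ (7 ℕ.+ μ₄) i * φ (9 ℕ.+ μ₄) i * φ (11 ℕ.+ (μ₄ ℕ.+ μ₂)) i
  block⁻ i = φ 1 i * φ (1 ℕ.+ μ₂) i * φ (3 ℕ.+ μ₂) i * φ (5 ℕ.+ μ₂) i
    * φ (7 ℕ.+ μ₄) i * φ (9 ℕ.+ μ₄) i * φ (11 ℕ.+ μ₄) i * φ (11 ℕ.+ (μ₄ ℕ.+ μ₂)) i

  private
    -- The six residues modulo 6M shared by G and F are the classes 1 and -1 modulo 2M, hence 3L
    -- factors in place of L.
    common : ℕ → Carrier
    common L = progression 1# (3 ℕ.+ μ₂) D₂ (L ℕ.* 3) * progression 1# 1 D₂ (L ℕ.* 3)

    common≈ : ∀ L → common L ≈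
      (progression 1# (3 ℕ.+ μ₂) D L * progression 1# (7 ℕ.+ μ₄) D L * progression 1# (11 ℕ.+ (μ₄ ℕ.+ μ₂)) D L)
      * (progression 1# 1 D L * progression 1# (5 ℕ.+ μ₂) D L * progression 1# (9 ℕ.+ μ₄) D L)
    common≈ L = *-cong
      (progression-thirds 1# (3 ℕ.+ μ₂) D₂ L (i₁ μ) (i₂ μ) (i₄ μ)) (progression-thirds 1# 1 D₂ L ≡.refl (i₃ μ) (i₄ μ))
      where
      i₁ : ∀ m → 3 ℕ.+ (m ℕ.+ m) ℕ.+ (4 ℕ.+ (m ℕ.+ m)) ≡ 7 ℕ.+ ((m ℕ.+ m) ℕ.+ (m ℕ.+ m))
      i₁ = ℕSolver.solve-∀
      i₂ : ∀ m → 7 ℕ.+ ((m ℕ.+ m) ℕ.+ (m ℕ.+ m)) ℕ.+ (4 ℕ.+ (m ℕ.+ m)) ≡ 11 ℕ.+ (((m ℕ.+ m) ℕ.+ (m ℕ.+ m)) ℕ.+ (m ℕ.+ m))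
      i₂ = ℕSolver.solve-∀
      i₄ : ∀ m → 4 ℕ.+ (m ℕ.+ m) ℕ.+ (4 ℕ.+ (m ℕ.+ m)) ℕ.+ (4 ℕ.+ (m ℕ.+ m)) ≡ 12 ℕ.+ (((m ℕ.+ m) ℕ.+ (m ℕ.+ m)) ℕ.+ (m ℕ.+ m))
      i₄ = ℕSolver.solve-∀
      i₃ : ∀ m → 5 ℕ.+ (m ℕ.+ m) ℕ.+ (4 ℕ.+ (m ℕ.+ m)) ≡ 9 ℕ.+ ((m ℕ.+ m) ℕ.+ (m ℕ.+ m))
      i₃ = ℕSolver.solve-∀

    prod-8 : ∀ L f₁ f₂ f₃ f₄ f₅ f₆ f₇ f₈ →
      prod L (λ i → f₁ i * f₂ i * f₃ i * f₄ i * f₅ i * f₆ i * f₇ i * f₈ i)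
        ≈ prod L f₁ * prod L f₂ * prod L f₃ * prod L f₄ * prod L f₅ * prod L f₆ * prod L f₇ * prod L f₈
    prod-8 L f₁ f₂ f₃ f₄ f₅ f₆ f₇ f₈ = trans (prod-* L _ f₈) (*-congʳ (trans (prod-* L _ f₇) (*-congʳ
      (trans (prod-* L _ f₆) (*-congʳ (trans (prod-* L _ f₅) (*-congʳ (trans (prod-* L _ f₄) (*-congʳ
      (trans (prod-* L _ f₃) (*-congʳ (prod-* L f₁ f₂))))))))))))

    blocks⁺ : ∀ L → prod L block⁺ ≈ common L * (progression 1# (7 ℕ.+ μ₂) D L * progression 1# (5 ℕ.+ μ₄) D L)
    blocks⁺ L = trans (prod-8 L (φ 1) (φ (3 ℕ.+ μ₂)) (φ (5 ℕ.+ μ₂)) (φ (7 ℕ.+ μ₂)) (φ (5 ℕ.+ μ₄)) (φ (7 ℕ.+ μ₄)) (φ (9 ℕ.+ μ₄)) (φ (11 ℕ.+ (μ₄ ℕ.+ μ₂))))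
      (trans (solve 8 (λ x₁ x₂ x₃ x₄ x₅ x₆ x₇ x₈ → x₁ :* x₂ :* x₃ :* x₄ :* x₅ :* x₆ :* x₇ :* x₈
          := (x₂ :* x₆ :* x₈) :* (x₁ :* x₃ :* x₇) :* (x₄ :* x₅)) refl _ _ _ _ _ _ _ _)
        (*-congʳ (sym (common≈ L))))

    blocks⁻ : ∀ L → prod L block⁻ ≈ common L * (progression 1# (11 ℕ.+ μ₄) D L * progression 1# (1 ℕ.+ μ₂) D L)
    blocks⁻ L = trans (prod-8 L (φ 1) (φ (1 ℕ.+ μ₂)) (φ (3 ℕ.+ μ₂)) (φ (5 ℕ.+ μ₂)) (φ (7 ℕ.+ μ₄)) (φ (9 ℕ.+ μ₄)) (φ (11 ℕ.+ μ₄)) (φ (11 ℕ.+ (μ₄ ℕ.+ μ₂))))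
      (trans (solve 8 (λ x₁ x₂ x₃ x₄ x₅ x₆ x₇ x₈ → x₁ :* x₂ :* x₃ :* x₄ :* x₅ :* x₆ :* x₇ :* x₈
          := (x₃ :* x₅ :* x₈) :* (x₁ :* x₄ :* x₆) :* (x₇ :* x₂)) refl _ _ _ _ _ _ _ _)
        (*-congʳ (sym (common≈ L))))

  difference : ℕ → Carrier
  difference L = prod L block⁺ + ν * (q * prod L block⁻)

  euler : ℕ → Carrier
  euler = progression ν D D

  module _ (N : ℕ) (q^N≈0 : q ^ N ≈ 0#) where

    open Truncated N q^N≈0

    private
      1^n≈1 : ∀ n → 1# ^ n ≈ 1#
      1^n≈1 zero = refl
      1^n≈1 (suc n) = trans (*-identityˡ _) (1^n≈1 n)

      triple₁ : ∀ a c {d L} → suc (a ℕ.+ suc c) ≡ d → N ℕ.+ N ℕ.≤ L →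
        progression ν d d L * (progression 1# (suc a) d L * progression 1# (suc c) d L)
          ≈ sumℤ N (λ k → q ^ expo (suc a) (suc c) k)
      triple₁ a c ≡.refl 2N≤L = trans (triple-product 1# (*-identityˡ 1#) a c 2N≤L)
        (sumℤ-cong N {g = λ k → q ^ expo (suc a) (suc c) k} (λ k → trans (*-congʳ (1^n≈1 ∣ k ∣)) (*-identityˡ _)))

    -- After multiplication by (q^(2M); q^(2M)) all products are triple products. The pentagonal
    -- number theorem exhibits the same factor on the right, and its inverse removes it.
    main-identity : ∀ {L} → N ℕ.+ N ℕ.≤ L → difference L * euler L ≈ sumℤ N t₄
    main-identity {L} 2N≤L = begin
      W                      ≈⟨ *-identityʳ W ⟨
      W * 1#                 ≈⟨ *-congˡ (trans (*-comm E₂ g) inverse) ⟨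
      W * (E₂ * g)           ≈⟨ *-assoc W E₂ g ⟨
      W * E₂ * g             ≈⟨ *-congʳ W*E₂ ⟩
      sumℤ N t₄ * E₂ * g     ≈⟨ *-assoc _ E₂ g ⟩
      sumℤ N t₄ * (E₂ * g)   ≈⟨ *-congˡ (trans (*-comm E₂ g) inverse) ⟩
      sumℤ N t₄ * 1#         ≈⟨ *-identityʳ _ ⟩
      sumℤ N t₄              ∎
      where
      W = difference L * euler L
      E₂ = progression ν D₂ D₂ (L ℕ.* 3)
      g = Gaussian.gauss D₂ N N
      X⁺ = progression 1# (7 ℕ.+ μ₂) D L * progression 1# (5 ℕ.+ μ₄) D L
      X⁻ = progression 1# (11 ℕ.+ μ₄) D L * progression 1# (1 ℕ.+ μ₂) D L
      2N≤3L : N ℕ.+ N ℕ.≤ L ℕ.* 3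
      2N≤3L = ℕₚ.≤-trans 2N≤L (ℕₚ.m≤m*n L 3)
      inverse : g * E₂ ≈ 1#
      inverse = gauss-inverse (3 ℕ.+ μ₂) ℕₚ.≤-refl ℕₚ.≤-refl (ℕₚ.≤-trans (ℕₚ.m≤m+n N N) 2N≤3L)
      i₀ : ∀ m → 3 ℕ.+ (m ℕ.+ m) ℕ.+ 1 ≡ 4 ℕ.+ (m ℕ.+ m)
      i₀ = ℕSolver.solve-∀
      i₁ : ∀ m → 7 ℕ.+ (m ℕ.+ m) ℕ.+ (5 ℕ.+ ((m ℕ.+ m) ℕ.+ (m ℕ.+ m))) ≡ 12 ℕ.+ (((m ℕ.+ m) ℕ.+ (m ℕ.+ m)) ℕ.+ (m ℕ.+ m))
      i₁ = ℕSolver.solve-∀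
      i₂ : ∀ m → 11 ℕ.+ ((m ℕ.+ m) ℕ.+ (m ℕ.+ m)) ℕ.+ (1 ℕ.+ (m ℕ.+ m)) ≡ 12 ℕ.+ (((m ℕ.+ m) ℕ.+ (m ℕ.+ m)) ℕ.+ (m ℕ.+ m))
      i₂ = ℕSolver.solve-∀
      E₂≈ : E₂ ≈ sumℤ N t₃
      E₂≈ = pentagonal (3 ℕ.+ μ₂) (ℕₚ.≤-trans (ℕₚ.m≤m+n N N) 2N≤3L)
      W*E₂ : W * E₂ ≈ sumℤ N t₄ * E₂
      W*E₂ = begin
        W * E₂
          ≈⟨ *-congʳ (*-congʳ (+-cong (blocks⁺ L) (*-congˡ (*-congˡ (blocks⁻ L))))) ⟩
        (common L * X⁺ + ν * (q * (common L * X⁻))) * euler L * E₂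
          ≈⟨ solve 7 (λ c x y n q e f → (c :* x :+ n :* (q :* (c :* y))) :* e :* f
               := (f :* c) :* (e :* x :+ n :* (q :* (e :* y)))) refl (common L) X⁺ X⁻ ν q (euler L) E₂ ⟩
        (E₂ * common L) * (euler L * X⁺ + ν * (q * (euler L * X⁻)))
          ≈⟨ *-cong (triple₁ (2 ℕ.+ μ₂) 0 (i₀ μ) 2N≤3L)
               (+-cong (triple₁ (6 ℕ.+ μ₂) (4 ℕ.+ μ₄) (i₁ μ) 2N≤L)
                 (*-congˡ (*-congˡ (triple₁ (10 ℕ.+ μ₄) μ₂ (i₂ μ) 2N≤L)))) ⟩
        sumℤ N t₀ * (sumℤ N t₁ + ν * (q * sumℤ N t₂))
          ≈⟨ theta-products N q^N≈0 ⟩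
        sumℤ N t₄ * sumℤ N t₃
          ≈⟨ *-congˡ E₂≈ ⟨
        sumℤ N t₄ * E₂
          ∎

    -- The form that shows the support: the Gaussian coefficient in base q^(6M) involves only powers
    -- of q^(6M).
    difference-quotient : ∀ {L} → N ℕ.+ N ℕ.≤ L → difference L ≈ Gaussian.gauss D N N * sumℤ N t₄
    difference-quotient {L} 2N≤L = begin
      W                      ≈⟨ *-identityˡ W ⟨
      1# * W                 ≈⟨ *-congʳ (gauss-inverse (11 ℕ.+ (μ₄ ℕ.+ μ₂)) ℕₚ.≤-refl ℕₚ.≤-refl (ℕₚ.≤-trans (ℕₚ.m≤m+n N N) 2N≤L)) ⟨
      g * euler L * W        ≈⟨ solve 3 (λ g e w → g :* e :* w := g :* (w :* e)) refl g (euler L) W ⟩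
      g * (W * euler L)      ≈⟨ *-congˡ (main-identity 2N≤L) ⟩
      g * sumℤ N t₄          ∎
      where
      W = difference L
      g = Gaussian.gauss D N N

    -- Read at one coefficient, this is a recurrence for the coefficients of G - q F along
    -- pentagonal steps.
    pentagonal-recurrence : ∀ {L} → N ℕ.+ N ℕ.≤ L →
      sumℤ N (λ k → sign k * (q ^ expo (D ℕ.+ D) D k * difference L)) ≈ sumℤ N t₄
    pentagonal-recurrence {L} 2N≤L = begin
      sumℤ N (λ k → sign k * (q ^ expo (D ℕ.+ D) D k * W))
        ≈⟨ sumℤ-cong N (λ k → solve 3 (λ s y w → s :* (y :* w) := w :* (s :* y)) refl (sign k) (q ^ expo (D ℕ.+ D) D k) W) ⟩
      sumℤ N (λ k → W * (sign k * q ^ expo (D ℕ.+ D) D k))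
        ≈⟨ sumℤ-*ˡ N W (λ k → sign k * q ^ expo (D ℕ.+ D) D k) ⟨
      W * sumℤ N (λ k → sign k * q ^ expo (D ℕ.+ D) D k)
        ≈⟨ *-congˡ (pentagonal (11 ℕ.+ (μ₄ ℕ.+ μ₂)) (ℕₚ.≤-trans (ℕₚ.m≤m+n N N) 2N≤L)) ⟨
      W * euler L
        ≈⟨ main-identity 2N≤L ⟩
      sumℤ N t₄
        ∎
      where W = difference L

-- Truncated power series

Series : Set
Series = ℕ → ℤ

open Sums ℤₚ.+-*-commutativeRing using (diag; diag-cong; diag-+; diag-*ˡ; diag-flip; diag-assoc)

infixl 7 _⋆_
opaque
  _⋆_ : Series → Series → Series
  (f ⋆ g) n = diag n (λ a b → f a ℤ.* g b)

one X : Series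
one zero = ℤ.1ℤ
one (suc n) = ℤ.0ℤ
X zero = ℤ.0ℤ
X (suc n) = one n

private
  diag-0 : ∀ n (g : ℕ → ℕ → ℤ) → (∀ a b → g a b ≡ ℤ.0ℤ) → diag n g ≡ ℤ.0ℤ
  diag-0 zero g g≡0 = g≡0 0 0
  diag-0 (suc n) g g≡0 = ≡.cong₂ ℤ._+_ (g≡0 0 (suc n)) (diag-0 n _ (λ a b → g≡0 (suc a) b))

opaque
  unfolding _⋆_

  ⋆-comm : ∀ f g n → (f ⋆ g) n ≡ (g ⋆ f) n
  ⋆-comm f g n = ≡.trans (diag-flip n _) (diag-cong n (λ a b _ → ℤₚ.*-comm (f b) (g a)))

  ⋆-assoc : ∀ f g h n → ((f ⋆ g) ⋆ h) n ≡ (f ⋆ (g ⋆ h)) n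
  ⋆-assoc f g h n = begin
    diag n (λ a b → diag a (λ i j → f i ℤ.* g j) ℤ.* h b)
      ≡⟨ diag-cong n (λ a b _ → ≡.trans (ℤₚ.*-comm _ (h b)) (diag-*ˡ a (h b) _)) ⟩
    diag n (λ a b → diag a (λ i j → h b ℤ.* (f i ℤ.* g j)))
      ≡⟨ diag-assoc n (λ i j b → h b ℤ.* (f i ℤ.* g j)) ⟩
    diag n (λ i a → diag a (λ j b → h b ℤ.* (f i ℤ.* g j)))
      ≡⟨ diag-cong n (λ i a _ → diag-cong a (λ j b _ → rotate (h b) (f i) (g j))) ⟩
    diag n (λ i a → diag a (λ j b → f i ℤ.* (g j ℤ.* h b)))
      ≡⟨ diag-cong n (λ i a _ → diag-*ˡ a (f i) _) ⟨
    diag n (λ i a → f i ℤ.* diag a (λ j b → g j ℤ.* h b))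
      ∎
    where
    open ≡.≡-Reasoning
    rotate : ∀ x y z → x ℤ.* (y ℤ.* z) ≡ y ℤ.* (z ℤ.* x)
    rotate = solve-∀

  ⋆-identityˡ : ∀ f n → (one ⋆ f) n ≡ f n
  ⋆-identityˡ f zero = ℤₚ.*-identityˡ (f 0)
  ⋆-identityˡ f (suc n) = ≡.trans
    (≡.cong₂ ℤ._+_ (ℤₚ.*-identityˡ (f (suc n))) (diag-0 n _ (λ a b → ℤₚ.*-zeroˡ (f b))))
    (ℤₚ.+-identityʳ _)

  ⋆-distribˡ : ∀ f g h n → (f ⋆ (λ i → g i ℤ.+ h i)) n ≡ (f ⋆ g) n ℤ.+ (f ⋆ h) n
  ⋆-distribˡ f g h n = ≡.trans (diag-cong n (λ a b _ → ℤₚ.*-distribˡ-+ (f a) (g b) (h b))) (diag-+ n _ _)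

  X⋆-zero : ∀ f → (X ⋆ f) 0 ≡ ℤ.0ℤ
  X⋆-zero f = ℤₚ.*-zeroˡ (f 0)

  X⋆-suc : ∀ f n → (X ⋆ f) (suc n) ≡ f n
  X⋆-suc f n = ≡.trans (≡.cong₂ ℤ._+_ (ℤₚ.*-zeroˡ (f (suc n))) (⋆-identityˡ f n)) (ℤₚ.+-identityˡ (f n))

-- Equality up to q^N makes q nilpotent, so that theta series become finite sums.
module _ (N : ℕ) where

  infix 4 _≋_
  record _≋_ (f g : Series) : Set where
    constructor agree
    field coeff : ∀ n → n ℕ.< N → f n ≡ g n

  open _≋_ public

  pointwise : ∀ {f g} → (∀ n → f n ≡ g n) → f ≋ g
  pointwise f≡g = agree (λ n _ → f≡g n)

  opaque
    unfolding _⋆_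

    ⋆-cong : ∀ {f f′ g g′} → f ≋ f′ → g ≋ g′ → (f ⋆ g) ≋ (f′ ⋆ g′)
    ⋆-cong f≋ g≋ = agree (λ n n<N → diag-cong n (λ a b a+b≡n → ≡.cong₂ ℤ._*_
      (coeff f≋ a (ℕₚ.≤-<-trans (ℕₚ.≤-trans (ℕₚ.m≤m+n a b) (ℕₚ.≤-reflexive a+b≡n)) n<N))
      (coeff g≋ b (ℕₚ.≤-<-trans (ℕₚ.≤-trans (ℕₚ.m≤n+m b a) (ℕₚ.≤-reflexive a+b≡n)) n<N))))

  isCommutativeRing : IsCommutativeRing _≋_ (λ f g n → f n ℤ.+ g n) _⋆_ (λ f n → ℤ.- f n) (λ _ → ℤ.0ℤ) one
  isCommutativeRing = record
    { isRing = record
      { +-isAbelianGroup = record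
        { isGroup = record
          { isMonoid = record
            { isSemigroup = record
              { isMagma = record
                { isEquivalence = record
                  { refl = pointwise (λ _ → ≡.refl)
                  ; sym = λ f≋g → agree (λ n n<N → ≡.sym (coeff f≋g n n<N))
                  ; trans = λ f≋g g≋h → agree (λ n n<N → ≡.trans (coeff f≋g n n<N) (coeff g≋h n n<N))
                  }
                ; ∙-cong = λ f≋ g≋ → agree (λ n n<N → ≡.cong₂ ℤ._+_ (coeff f≋ n n<N) (coeff g≋ n n<N))
                }
              ; assoc = λ f g h → pointwise (λ n → ℤₚ.+-assoc (f n) (g n) (h n))
              }
            ; identity = (λ f → pointwise (λ n → ℤₚ.+-identityˡ (f n))) , (λ f → pointwise (λ n → ℤₚ.+-identityʳ (f n)))
            }
          ; inverse = (λ f → pointwise (λ n → ℤₚ.+-inverseˡ (f n))) , (λ f → pointwise (λ n → ℤₚ.+-inverseʳ (f n)))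
          ; ⁻¹-cong = λ f≋ → agree (λ n n<N → ≡.cong ℤ.-_ (coeff f≋ n n<N))
          }
        ; comm = λ f g → pointwise (λ n → ℤₚ.+-comm (f n) (g n))
        }
      ; *-cong = ⋆-cong
      ; *-assoc = λ f g h → pointwise (⋆-assoc f g h)
      ; *-identity = (λ f → pointwise (⋆-identityˡ f)) ,
          (λ f → pointwise (λ n → ≡.trans (⋆-comm f one n) (⋆-identityˡ f n)))
      ; distrib = (λ f g h → pointwise (⋆-distribˡ f g h)) ,
          (λ f g h → pointwise (λ n → ≡.trans (⋆-comm (λ i → g i ℤ.+ h i) f n)
            (≡.trans (⋆-distribˡ f g h n) (≡.cong₂ ℤ._+_ (⋆-comm f g n) (⋆-comm f h n)))))
      }
    ; *-comm = λ f g → pointwise (⋆-comm f g)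
    }

  seriesRing : CommutativeRing 0ℓ 0ℓ
  seriesRing = record { isCommutativeRing = isCommutativeRing }

-- Partition counts as coefficients

shift : ℕ → Series → Series
shift zero f n = f n
shift (suc e) f zero = ℤ.0ℤ
shift (suc e) f (suc n) = shift e f n

shift-≤ : ∀ e f {n} → e ℕ.≤ n → shift e f n ≡ f (n ℕ.∸ e)
shift-≤ zero f _ = ≡.refl
shift-≤ (suc e) f (ℕ.s≤s e≤n) = shift-≤ e f e≤n

shift-> : ∀ e f {n} → n ℕ.< e → shift e f n ≡ ℤ.0ℤ
shift-> (suc e) f {zero} _ = ≡.refl
shift-> (suc e) f {suc n} (ℕ.s≤s n<e) = shift-> e f n<e

shift-one : ∀ e {n} → n ≢ e → shift e one n ≡ ℤ.0ℤ
shift-one zero {zero} n≢e = contradiction ≡.refl n≢e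
shift-one zero {suc n} n≢e = ≡.refl
shift-one (suc e) {zero} n≢e = ≡.refl
shift-one (suc e) {suc n} n≢e = shift-one e (λ n≡e → n≢e (≡.cong suc n≡e))

module _ (p : ℕ → Bool) where

  private
    keep-cons : ∀ x (ls : List (List ℕ)) → length (filterᵇ (all p) (map (x ∷_) ls))
      ≡ (if p x then length (filterᵇ (all p) ls) else 0)
    keep-cons x [] with p x
    ... | true = ≡.refl
    ... | false = ≡.refl
    keep-cons x (l ∷ ls) with p x | keep-cons x ls
    ... | false | ih = ih
    ... | true | ih with all p l
    ...   | true = ≡.cong suc ih
    ...   | false = ih

  countUpTo : ℕ → ℕ → ℕ
  countUpTo k n = length (filterᵇ (all p) (strictDecr k n))

  countUpTo-≤ : ∀ k n → suc k ℕ.≤ n → countUpTo (suc k) n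
    ≡ countUpTo k n ℕ.+ (if p (suc k) then countUpTo k (n ℕ.∸ suc k) else 0)
  countUpTo-≤ k n k<n with suc k ℕ.≤? n
  ... | no k≮n = contradiction k<n k≮n
  ... | yes _ = ≡.trans
    (≡.cong length (filter-++ (λ l → Bool.T? (all p l)) (strictDecr k n) (map (suc k ∷_) (strictDecr k (n ℕ.∸ suc k)))))
    (≡.trans (length-++ (filterᵇ (all p) (strictDecr k n)))
      (≡.cong (countUpTo k n ℕ.+_) (keep-cons (suc k) (strictDecr k (n ℕ.∸ suc k)))))

  countUpTo-> : ∀ k n → n ℕ.< suc k → countUpTo (suc k) n ≡ countUpTo k n
  countUpTo-> k n n<k with suc k ℕ.≤? n
  ... | no _ = ≡.refl
  ... | yes k<n = contradiction k<n (ℕₚ.<⇒≱ n<k)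

  countUpTo-stable : ∀ m n → countUpTo (m ℕ.+ n) n ≡ countDistinct p n
  countUpTo-stable zero n = ≡.refl
  countUpTo-stable (suc m) n = ≡.trans (countUpTo-> (m ℕ.+ n) n (ℕ.s≤s (ℕₚ.m≤n+m n m))) (countUpTo-stable m n)

module Coefficients (N : ℕ) where

  R : CommutativeRing 0ℓ 0ℓ
  R = seriesRing N

  open CommutativeRing R hiding (zero)
  open Sums R
  open Nilpotent R X
  open import Algebra.Properties.Ring ring using (-1*x≈-x)

  ν*-coeff : ∀ f {n} → n ℕ.< N → (ν * f) n ≡ ℤ.- f n
  ν*-coeff f {n} n<N = coeff (-1*x≈-x f) n n<N

  X^*-coeff : ∀ e f {n} → n ℕ.< N → (X ^ e * f) n ≡ shift e f n
  X^*-coeff zero f {n} n<N = coeff (*-identityˡ f) n n<N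
  X^*-coeff (suc e) f {zero} n<N = ≡.trans (coeff (*-assoc X (X ^ e) f) 0 n<N) (X⋆-zero (X ^ e * f))
  X^*-coeff (suc e) f {suc n} n<N = ≡.trans (coeff (*-assoc X (X ^ e) f) (suc n) n<N)
    (≡.trans (X⋆-suc (X ^ e * f) n) (X^*-coeff e f (ℕₚ.<⇒≤ n<N)))

  X^-coeff : ∀ e {n} → n ℕ.< N → (X ^ e) n ≡ shift e one n
  X^-coeff e {n} n<N = ≡.trans (≡.sym (coeff (*-identityʳ (X ^ e)) n n<N)) (X^*-coeff e one n<N)

  X^N≈0 : X ^ N ≈ 0#
  X^N≈0 = agree (λ n n<N → ≡.trans (X^-coeff N n<N) (shift-one N (ℕₚ.<⇒≢ n<N)))

  open Truncated N X^N≈0 public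

  factor-coeff : ∀ f e {n} → n ℕ.< N → (f * factor 1# e) n ≡ f n ℤ.+ shift e f n
  factor-coeff f e {n} n<N = ≡.trans (coeff (*-factor₁ f e) n n<N) (≡.cong (λ z → f n ℤ.+ z) (X^*-coeff e f n<N))

  -- The factor for k + 1 mirrors the recursion of `strictDecr`: the part k + 1 is either absent or
  -- used once.
  countUpTo-coeff : ∀ p k {n} → n ℕ.< N → prod k (λ i → part p (suc i)) n ≡ + countUpTo p k n
  countUpTo-coeff p zero {zero} n<N = ≡.refl
  countUpTo-coeff p zero {suc n} n<N = ≡.refl
  countUpTo-coeff p (suc k) {n} n<N with ℕₚ.≤-<-connex (suc k) n
  ... | inj₁ k<n = ≡.trans step (≡.cong +_ (≡.sym (countUpTo-≤ p k n k<n)))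
    where
    P = prod k (λ i → part p (suc i))
    step : (P * part p (suc k)) n ≡ + (countUpTo p k n ℕ.+ (if p (suc k) then countUpTo p k (n ℕ.∸ suc k) else 0))
    step with p (suc k)
    ... | true = ≡.trans (factor-coeff P (suc k) n<N) (≡.cong₂ ℤ._+_ (countUpTo-coeff p k n<N)
      (≡.trans (shift-≤ (suc k) P k<n) (countUpTo-coeff p k (ℕₚ.≤-<-trans (ℕₚ.m∸n≤m n (suc k)) n<N))))
    ... | false = ≡.trans (coeff (*-identityʳ P) n n<N) (≡.trans (countUpTo-coeff p k n<N)
      (≡.cong +_ (≡.sym (ℕₚ.+-identityʳ (countUpTo p k n)))))
  ... | inj₂ n<k = ≡.trans step (≡.cong +_ (≡.sym (countUpTo-> p k n n<k)))
    where
    P = prod k (λ i → part p (suc i))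
    step : (P * part p (suc k)) n ≡ + countUpTo p k n
    step with p (suc k)
    ... | true = ≡.trans (factor-coeff P (suc k) n<N) (≡.trans (≡.cong₂ ℤ._+_ (countUpTo-coeff p k n<N)
      (shift-> (suc k) P n<k)) (ℤₚ.+-identityʳ _))
    ... | false = ≡.trans (coeff (*-identityʳ P) n n<N) (countUpTo-coeff p k n<N)

  countDistinct-coeff : ∀ p k {n} → n ℕ.≤ k → n ℕ.< N → prod k (λ i → part p (suc i)) n ≡ + countDistinct p n
  countDistinct-coeff p k {n} n≤k n<N = ≡.trans (countUpTo-coeff p k n<N)
    (≡.cong +_ (≡.trans (≡.cong (λ m → countUpTo p m n) (≡.sym (ℕₚ.m∸n+n≡m n≤k))) (countUpTo-stable p (k ℕ.∸ n) n)))

  sumℤ-coeff : ∀ B (h : ℤ → Carrier) n → sumℤ B h n ≡ Sums.sumℤ ℤₚ.+-*-commutativeRing B (λ k → h k n)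
  sumℤ-coeff zero h n = ≡.refl
  sumℤ-coeff (suc B) h n = ≡.cong (λ z → z ℤ.+ (h (+ B) n ℤ.+ h -[1+ B ] n)) (sumℤ-coeff B h n)

  private
    ν^suc-coeff : ∀ m f {n} → n ℕ.< N → (ν ^ suc m * f) n ≡ ℤ.- (ν ^ m * f) n
    ν^suc-coeff m f {n} n<N = ≡.trans (coeff (*-assoc ν (ν ^ m) f) n n<N) (ν*-coeff (ν ^ m * f) n<N)

  ν^*-zero : ∀ m f {n} → n ℕ.< N → f n ≡ ℤ.0ℤ → (ν ^ m * f) n ≡ ℤ.0ℤ
  ν^*-zero zero f {n} n<N f≡0 = ≡.trans (coeff (*-identityˡ f) n n<N) f≡0
  ν^*-zero (suc m) f n<N f≡0 = ≡.trans (ν^suc-coeff m f n<N) (≡.cong ℤ.-_ (ν^*-zero m f n<N f≡0))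

  ν^*-cancel : ∀ m f {n} → n ℕ.< N → (ν ^ m * f) n ≡ ℤ.0ℤ → f n ≡ ℤ.0ℤ
  ν^*-cancel zero f {n} n<N eq = ≡.trans (≡.sym (coeff (*-identityˡ f) n n<N)) eq
  ν^*-cancel (suc m) f {n} n<N eq = ν^*-cancel m f n<N
    (ℤₚ.neg-injective (≡.trans (≡.sym (ν^suc-coeff m f n<N)) eq))

-- Residues modulo 6 and pentagonal numbers

Admissible : ℕ → Set
Admissible n = n % 6 ≡ 0 ⊎ n % 6 ≡ 2

admissible-+6 : ∀ m n → Admissible n → Admissible (n ℕ.+ m ℕ.* 6)
admissible-+6 m n = ≡.subst (λ r → r ≡ 0 ⊎ r ≡ 2) (≡.sym ([m+kn]%n≡m%n n m 6))

tri-mono : ∀ {m n} → m ℕ.≤ n → tri m ℕ.≤ tri n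
tri-mono ℕ.z≤n = ℕ.z≤n
tri-mono (ℕ.s≤s m≤n) = ℕₚ.+-mono-≤ (ℕ.s≤s m≤n) (tri-mono m≤n)

tri⁻-mono : ∀ {m n} → m ℕ.≤ n → tri⁻ (+ m) ℕ.≤ tri⁻ (+ n)
tri⁻-mono ℕ.z≤n = ℕ.z≤n
tri⁻-mono (ℕ.s≤s m≤n) = tri-mono m≤n

tri⁻≤tri : ∀ n → tri⁻ (+ n) ℕ.≤ tri n
tri⁻≤tri n = ℕₚ.≤-trans (ℕₚ.m≤n+m _ n) (ℕₚ.≤-reflexive (≡.sym (tri≡n+tri⁻ n)))

-- The pentagonal number k (3k + 1) / 2.
pent : ℤ → ℕ
pent k = tri⁺ k ℕ.+ tri⁺ k ℕ.+ tri⁻ k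

opaque
  unfolding expo

  expo≡*pent : ∀ d k → expo (d ℕ.+ d) d k ≡ d ℕ.* pent k
  expo≡*pent d k = identity d (tri⁺ k) (tri⁻ k)
    where
    identity : ∀ d x y → (d ℕ.+ d) ℕ.* x ℕ.+ d ℕ.* y ≡ d ℕ.* (x ℕ.+ x ℕ.+ y)
    identity = ℕSolver.solve-∀

private
  pent-mono : ∀ {m n} → m ℕ.≤ n → pent (+ m) ℕ.≤ pent (+ n)
  pent-mono m≤n = ℕₚ.+-mono-≤ (ℕₚ.+-mono-≤ (tri-mono m≤n) (tri-mono m≤n)) (tri⁻-mono m≤n)

  pent-step : ∀ n → pent (+ n) ℕ.+ suc n ℕ.≤ pent (+ suc n)
  pent-step n = begin
    tri n ℕ.+ tri n ℕ.+ tri⁻ (+ n) ℕ.+ suc n     ≤⟨ ℕₚ.+-monoˡ-≤ (suc n) (ℕₚ.+-monoʳ-≤ (tri n ℕ.+ tri n) (tri⁻≤tri n)) ⟩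
    tri n ℕ.+ tri n ℕ.+ tri n ℕ.+ suc n          ≤⟨ ℕₚ.m≤m+n _ (suc n) ⟩
    tri n ℕ.+ tri n ℕ.+ tri n ℕ.+ suc n ℕ.+ suc n ≡⟨ identity (tri n) (suc n) ⟩
    pent (+ suc n)                               ∎
    where
    open ℕₚ.≤-Reasoning
    identity : ∀ t s → t ℕ.+ t ℕ.+ t ℕ.+ s ℕ.+ s ≡ (s ℕ.+ t) ℕ.+ (s ℕ.+ t) ℕ.+ t
    identity = ℕSolver.solve-∀

-- Pentagonal numbers increase along the indices 0, -1, 1, -2, 2, ...; just below index j = m + 1
-- comes index -j, at distance exactly j.
pent-gap : ∀ m k → k ≢ + suc m → pent (+ suc m) ℕ.< pent k ⊎ pent k ℕ.+ suc m ℕ.≤ pent (+ suc m)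
pent-gap m (+ l) k≢ with ℕₚ.<-cmp l (suc m)
... | tri< l<j _ _ = inj₂ (ℕₚ.≤-trans (ℕₚ.+-monoˡ-≤ (suc m) (pent-mono (ℕ.s≤s⁻¹ l<j))) (pent-step m))

... | tri≈ _ l≡j _ = contradiction (≡.cong +_ l≡j) k≢

... | tri> _ _ j<l = inj₁ (ℕₚ.≤-trans (ℕₚ.≤-trans (ℕₚ.≤-trans (ℕₚ.m≤m+n _ (suc m))
    (ℕₚ.≤-reflexive (≡.sym (ℕₚ.+-suc (pent (+ suc m)) (suc m))))) (pent-step (suc m))) (pent-mono j<l))

pent-gap m -[1+ l ] _ with ℕₚ.≤-<-connex l m
... | inj₁ l≤m = inj₂ (begin
  tri l ℕ.+ tri l ℕ.+ tri (suc l) ℕ.+ suc m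
    ≤⟨ ℕₚ.+-monoˡ-≤ (suc m) (ℕₚ.+-mono-≤ (ℕₚ.+-mono-≤ (tri-mono l≤m) (tri-mono l≤m)) (tri-mono (ℕ.s≤s l≤m))) ⟩
  tri m ℕ.+ tri m ℕ.+ tri (suc m) ℕ.+ suc m
    ≡⟨ identity (tri m) (suc m) ⟩
  pent (+ suc m)
    ∎)
  where
  open ℕₚ.≤-Reasoning
  identity : ∀ t s → t ℕ.+ t ℕ.+ (s ℕ.+ t) ℕ.+ s ≡ (s ℕ.+ t) ℕ.+ (s ℕ.+ t) ℕ.+ t
  identity = ℕSolver.solve-∀
... | inj₂ m<l = inj₁ (ℕₚ.+-mono-≤-< (ℕₚ.+-mono-≤ (tri-mono m<l) (tri-mono m<l))
    (ℕ.s≤s (ℕₚ.≤-trans (tri-mono (ℕₚ.<⇒≤ m<l)) (ℕₚ.m≤n+m (tri l) l))))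

-- The difference of the two counts

module AdmissibleSeries (N : ℕ) where

  open CommutativeRing (seriesRing N) using (Carrier; _≈_; _+_; _*_; *-assoc; *-identityˡ; distribʳ; trans; *-congʳ)
  open Coefficients N
  open Sums (seriesRing N)
  open Nilpotent (seriesRing N) X

  AdmissibleSupport : Carrier → Set
  AdmissibleSupport f = ∀ n → n ℕ.< N → Admissible n ⊎ f n ≡ ℤ.0ℤ

  admissible-≈ : ∀ {f g} → f ≈ g → AdmissibleSupport g → AdmissibleSupport f
  admissible-≈ f≈g g-admissible n n<N with g-admissible n n<N
  ... | inj₁ adm = inj₁ adm
  ... | inj₂ g≡0 = inj₂ (≡.trans (coeff f≈g n n<N) g≡0)

  admissible-+ : ∀ {f g} → AdmissibleSupport f → AdmissibleSupport g → AdmissibleSupport (f + g)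
  admissible-+ f-admissible g-admissible n n<N with f-admissible n n<N | g-admissible n n<N
  ... | inj₁ adm | _ = inj₁ adm
  ... | inj₂ _ | inj₁ adm = inj₁ adm
  ... | inj₂ f≡0 | inj₂ g≡0 = inj₂ (≡.cong₂ ℤ._+_ f≡0 g≡0)

  admissible-ν^* : ∀ m {f} → AdmissibleSupport f → AdmissibleSupport (ν ^ m * f)
  admissible-ν^* m {f} f-admissible n n<N with f-admissible n n<N
  ... | inj₁ adm = inj₁ adm
  ... | inj₂ f≡0 = inj₂ (ν^*-zero m f n<N f≡0)

  admissible-X^ : ∀ {e} → Admissible e → AdmissibleSupport (X ^ e)
  admissible-X^ {e} adm n n<N with n ℕ.≟ e
  ... | yes ≡.refl = inj₁ adm
  ... | no n≢e = inj₂ (≡.trans (X^-coeff e n<N) (shift-one e n≢e))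

  admissible-X^6m* : ∀ m {f} → AdmissibleSupport f → AdmissibleSupport (X ^ (m ℕ.* 6) * f)
  admissible-X^6m* m {f} f-admissible n n<N with ℕₚ.≤-<-connex (m ℕ.* 6) n
  ... | inj₂ n<6m = inj₂ (≡.trans (X^*-coeff (m ℕ.* 6) f n<N) (shift-> (m ℕ.* 6) f n<6m))
  ... | inj₁ 6m≤n with f-admissible (n ℕ.∸ m ℕ.* 6) (ℕₚ.≤-<-trans (ℕₚ.m∸n≤m n (m ℕ.* 6)) n<N)
  ...   | inj₁ adm = inj₁ (≡.subst Admissible (ℕₚ.m∸n+n≡m 6m≤n) (admissible-+6 m (n ℕ.∸ m ℕ.* 6) adm))
  ...   | inj₂ f≡0 = inj₂ (≡.trans (X^*-coeff (m ℕ.* 6) f n<N) (≡.trans (shift-≤ (m ℕ.* 6) f 6m≤n) f≡0))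

  admissible-sumℤ : ∀ B (h : ℤ → Carrier) → (∀ k → AdmissibleSupport (h k)) → AdmissibleSupport (sumℤ B h)
  admissible-sumℤ zero h h-admissible n n<N = inj₂ ≡.refl
  admissible-sumℤ (suc B) h h-admissible = admissible-+ (admissible-sumℤ B h h-admissible) (admissible-+ (h-admissible (+ B)) (h-admissible -[1+ B ]))

  module _ (d m : ℕ) (d≡6m : d ≡ m ℕ.* 6) where

    open Gaussian d

    -- By the Pascal recursion, multiplication by the coefficient is composed of sums and
    -- multiplications by powers of X^6.
    admissible-gauss* : ∀ a b {f} → AdmissibleSupport f → AdmissibleSupport (gauss a b * f)
    admissible-gauss* zero b {f} f-admissible = admissible-≈ (*-identityˡ f) f-admissible
    admissible-gauss* (suc a) zero {f} f-admissible = admissible-≈ (*-identityˡ f) f-admissible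
    admissible-gauss* (suc a) (suc b) {f} f-admissible = admissible-≈ (distribʳ f (gauss a (suc b)) (p^ (suc a) * gauss (suc a) b))
      (admissible-+ (admissible-gauss* a (suc b) f-admissible)
        (admissible-≈ (trans (*-assoc (p^ (suc a)) (gauss (suc a) b) f) (*-congʳ (q^ exponent)))
          (admissible-X^6m* (suc a ℕ.* m) (admissible-gauss* (suc a) b f-admissible))))
      where
      exponent : d ℕ.* suc a ≡ (suc a ℕ.* m) ℕ.* 6
      exponent = ≡.trans (ℕₚ.*-comm d (suc a)) (≡.trans (≡.cong (suc a ℕ.*_) d≡6m) (≡.sym (ℕₚ.*-assoc (suc a) m 6)))

-- The n-th coefficient of G - q F; the factor q pairs n with n - 1, so at 0 only G contributes.
excess : (ℕ → Bool) → (ℕ → Bool) → ℕ → ℤ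
excess p⁺ p⁻ zero = + countDistinct p⁺ 0
excess p⁺ p⁻ (suc n) = + countDistinct p⁺ (suc n) ℤ.- + countDistinct p⁻ n

-- The factorisations are assumed in every ring because the truncation N, and with it the ring,
-- varies with the coefficient considered.
module Pair (μ : ℕ) (p⁺ p⁻ : ℕ → Bool)
  (split⁺ : ∀ {c ℓ} (R : CommutativeRing c ℓ) q i → CommutativeRing._≈_ R
    (Sums.prod R (Quintuple.D R q μ) (λ j → Nilpotent.part R q p⁺ (suc (j ℕ.+ i ℕ.* Quintuple.D R q μ))))
    (Quintuple.block⁺ R q μ i))
  (split⁻ : ∀ {c ℓ} (R : CommutativeRing c ℓ) q i → CommutativeRing._≈_ R
    (Sums.prod R (Quintuple.D R q μ) (λ j → Nilpotent.part R q p⁻ (suc (j ℕ.+ i ℕ.* Quintuple.D R q μ))))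
    (Quintuple.block⁻ R q μ i))
  where

  open Exponents μ

  private
    d = 12 ℕ.+ (μ₄ ℕ.+ μ₂)

  module _ (N : ℕ) where

    open CommutativeRing (seriesRing N) using (_*_; trans)
    open Coefficients N
    open Sums (seriesRing N)
    open Nilpotent (seriesRing N) X
    open Quintuple (seriesRing N) X μ

    private
      L = N ℕ.+ N

      bound : ∀ {n} → n ℕ.< N → n ℕ.≤ L ℕ.* D
      bound n<N = ℕₚ.≤-trans (ℕₚ.<⇒≤ n<N) (ℕₚ.≤-trans (ℕₚ.m≤m+n N N) (ℕₚ.m≤m*n L D))

    excess-coeff : ∀ n → n ℕ.< N → difference L n ≡ excess p⁺ p⁻ n
    excess-coeff n n<N = ≡.trans (≡.cong₂ ℤ._+_ plus (ν*-coeff (X * prod L block⁻) n<N)) (minus n n<N)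
      where
      plus : prod L block⁺ n ≡ + countDistinct p⁺ n
      plus = ≡.trans (≡.sym (coeff (trans (prod-blocks D L (λ i → part p⁺ (suc i))) (prod-cong L (split⁺ (seriesRing N) X))) n n<N))
        (countDistinct-coeff p⁺ (L ℕ.* D) (bound n<N) n<N)
      minus : ∀ n → n ℕ.< N → + countDistinct p⁺ n ℤ.+ ℤ.- (X * prod L block⁻) n ≡ excess p⁺ p⁻ n
      minus zero _ = ≡.trans (≡.cong (λ z → + countDistinct p⁺ 0 ℤ.+ ℤ.- z) (X⋆-zero (prod L block⁻))) (ℤₚ.+-identityʳ _)
      minus (suc n) n<N = ≡.cong (λ z → + countDistinct p⁺ (suc n) ℤ.+ ℤ.- z) (≡.trans (X⋆-suc (prod L block⁻) n)
        (≡.trans (≡.sym (coeff (trans (prod-blocks D L (λ i → part p⁻ (suc i))) (prod-cong L (split⁻ (seriesRing N) X))) n (ℕₚ.<⇒≤ n<N)))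
          (countDistinct-coeff p⁻ (L ℕ.* D) (bound (ℕₚ.<⇒≤ n<N)) (ℕₚ.<⇒≤ n<N))))

  module _ (e₄-admissible : ∀ k → Admissible (e₄ k)) where

    excess-support : ∀ n → Admissible n ⊎ excess p⁺ p⁻ n ≡ ℤ.0ℤ
    excess-support n = Sum.map₂ (≡.trans (≡.sym (excess-coeff N n ℕₚ.≤-refl)))
      (admissible-≈ (difference-quotient N (Coefficients.X^N≈0 N) ℕₚ.≤-refl)
        (admissible-gauss* D (2 ℕ.+ μ) (sixfold μ) N N (admissible-sumℤ N t₄ (λ k → admissible-ν^* ∣ k ∣ {X ^ e₄ k} (admissible-X^ {e₄ k} (e₄-admissible k))))) n ℕₚ.≤-refl)
      where
      -- The smallest truncation that still determines the coefficient at n.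
      N = suc n
      open AdmissibleSeries N
      open Nilpotent (seriesRing N) X using (_^_)
      open Quintuple (seriesRing N) X μ
      sixfold : ∀ m → 12 ℕ.+ (((m ℕ.+ m) ℕ.+ (m ℕ.+ m)) ℕ.+ (m ℕ.+ m)) ≡ (2 ℕ.+ m) ℕ.* 6
      sixfold = ℕSolver.solve-∀

    module _ (no-term : ∀ m k → e₄ k ≢ expo (d ℕ.+ d) d (+ suc m)) where

      -- If the excess vanished on [m, T], with T the exponent of index j = m + 1 in Euler's product, then
      -- comparing coefficients at T would give excess 0 = 0, because of the gap below T.
      not-all-zero : ∀ m → ¬ (∀ i → m ℕ.≤ i → i ℕ.≤ expo (d ℕ.+ d) d (+ suc m) → excess p⁺ p⁻ i ≡ ℤ.0ℤ)
      -- The excess at 0 is 1, from the empty partition.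
      not-all-zero m zeros = contradiction (≡.trans (≡.sym (excess-coeff N 0 (ℕ.s≤s ℕ.z≤n))) constant-term) (λ ())
        where
        T = expo (d ℕ.+ d) d (+ suc m)
        N = suc T
        open CommutativeRing (seriesRing N) using (_*_)
        open Coefficients N
        open Nilpotent (seriesRing N) X
        open Quintuple (seriesRing N) X μ
        open Sums ℤₚ.+-*-commutativeRing using (sumℤ; sumℤ-0; sum-single)
        T<N : T ℕ.< N
        T<N = ℕₚ.≤-refl
        W = difference (N ℕ.+ N)
        term : ℤ → ℤ
        term k = (sign k * (X ^ expo (d ℕ.+ d) d k * W)) T

        sum≡0 : sumℤ N term ≡ ℤ.0ℤ
        sum≡0 = ≡.trans (≡.sym (sumℤ-coeff N (λ k → sign k * (X ^ expo (d ℕ.+ d) d k * W)) T))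
          (≡.trans (coeff (pentagonal-recurrence N X^N≈0 ℕₚ.≤-refl) T T<N)
            (≡.trans (sumℤ-coeff N t₄ T) (sumℤ-0 N (λ k → t₄ k T) (λ k → ν^*-zero ∣ k ∣ (X ^ e₄ k) T<N
              (≡.trans (X^-coeff (e₄ k) T<N) (shift-one (e₄ k) (λ T≡ → no-term m k (≡.sym T≡))))))))

        term≡0 : ∀ k → k ≢ + suc m → term k ≡ ℤ.0ℤ
        term≡0 k k≢ = ν^*-zero ∣ k ∣ (X ^ expo (d ℕ.+ d) d k * W) T<N (≡.trans (X^*-coeff (expo (d ℕ.+ d) d k) W T<N) (shifted (pent-gap m k k≢)))
          where
          e≡ : expo (d ℕ.+ d) d k ≡ d ℕ.* pent k
          e≡ = expo≡*pent d k
          T≡ : T ≡ d ℕ.* pent (+ suc m)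
          T≡ = expo≡*pent d (+ suc m)
          shifted : pent (+ suc m) ℕ.< pent k ⊎ pent k ℕ.+ suc m ℕ.≤ pent (+ suc m) → shift (expo (d ℕ.+ d) d k) W T ≡ ℤ.0ℤ
          shifted (inj₁ above) = shift-> _ W (≡.subst₂ ℕ._<_ (≡.sym T≡) (≡.sym e≡) (ℕₚ.*-monoʳ-< d above))
          -- The pentagonal gap is at least m + 1 and is scaled by the positive d, so T - e lies in
          -- [m, T], where the excess is assumed to vanish.
          shifted (inj₂ below) = ≡.trans (shift-≤ _ W e≤T) (≡.trans (excess-coeff N i (ℕ.s≤s i≤T)) (zeros i m≤i i≤T))
            where
            i = T ℕ.∸ expo (d ℕ.+ d) d k
            i≤T : i ℕ.≤ T
            i≤T = ℕₚ.m∸n≤m T (expo (d ℕ.+ d) d k)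
            m+e≤T : m ℕ.+ expo (d ℕ.+ d) d k ℕ.≤ T
            m+e≤T = begin
              m ℕ.+ expo (d ℕ.+ d) d k           ≡⟨ ≡.trans (ℕₚ.+-comm m _) (≡.cong (ℕ._+ m) e≡) ⟩
              d ℕ.* pent k ℕ.+ m                 ≤⟨ ℕₚ.+-monoʳ-≤ (d ℕ.* pent k) (ℕₚ.≤-trans (ℕₚ.n≤1+n m) (ℕₚ.m≤n*m (suc m) d)) ⟩
              d ℕ.* pent k ℕ.+ d ℕ.* suc m       ≡⟨ ℕₚ.*-distribˡ-+ d (pent k) (suc m) ⟨
              d ℕ.* (pent k ℕ.+ suc m)           ≤⟨ ℕₚ.*-monoʳ-≤ d below ⟩
              d ℕ.* pent (+ suc m)               ≡⟨ T≡ ⟨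
              T                                  ∎
              where open ℕₚ.≤-Reasoning
            e≤T : expo (d ℕ.+ d) d k ℕ.≤ T
            e≤T = ℕₚ.m+n≤o⇒n≤o m m+e≤T
            m≤i : m ℕ.≤ i
            m≤i = ℕₚ.m+n≤o⇒m≤o∸n m m+e≤T

        j<N : suc m ℕ.< N
        j<N = ℕ.s≤s (∣k∣≤expo _ _ (+ suc m))

        term-j≡0 : term (+ suc m) ≡ ℤ.0ℤ
        term-j≡0 = begin
          term (+ suc m)                          ≡⟨ ℤₚ.+-identityʳ _ ⟨
          term (+ suc m) ℤ.+ ℤ.0ℤ                 ≡⟨ ≡.cong (λ z → term (+ suc m) ℤ.+ z) (term≡0 -[1+ suc m ] (λ ())) ⟨
          term (+ suc m) ℤ.+ term -[1+ suc m ]    ≡⟨ sum-single N (suc m) (λ i → term (+ i) ℤ.+ term -[1+ i ]) j<N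
                                                       (λ i i≢j → ≡.cong₂ ℤ._+_ (term≡0 (+ i) (λ eq → i≢j (ℤₚ.+-injective eq))) (term≡0 -[1+ i ] (λ ()))) ⟨
          sumℤ N term                             ≡⟨ sum≡0 ⟩
          ℤ.0ℤ                                    ∎
          where open ≡.≡-Reasoning

        constant-term : W 0 ≡ ℤ.0ℤ
        constant-term = ≡.trans (≡.cong W (≡.sym (ℕₚ.n∸n≡0 T)))
          (≡.trans (≡.sym (≡.trans (X^*-coeff T W T<N) (shift-≤ T W ℕₚ.≤-refl)))
            (ν^*-cancel (suc m) (X ^ T * W) T<N term-j≡0))

      -- Vanishing is decidable and the interval is finite, so a bounded search turns the refutation
      -- into a witness.
      nonzero-excess : ∀ m → ∃[ n ] (m ℕ.≤ n × excess p⁺ p⁻ n ≢ ℤ.0ℤ)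
      nonzero-excess m = search (ℕₚ.anyUpTo? (λ i → (m ℕ.≤? i) ×-dec ¬? (excess p⁺ p⁻ i ℤ.≟ ℤ.0ℤ)) (suc (expo (d ℕ.+ d) d (+ suc m))))
        where
        search : Dec (∃[ n ] (n ℕ.< suc (expo (d ℕ.+ d) d (+ suc m)) × m ℕ.≤ n × excess p⁺ p⁻ n ≢ ℤ.0ℤ)) →
          ∃[ n ] (m ℕ.≤ n × excess p⁺ p⁻ n ≢ ℤ.0ℤ)
        search (yes (n , _ , m≤n , nonzero)) = n , m≤n , nonzero
        search (no none) = contradiction
          (λ i m≤i i≤T → decidable-stable (excess p⁺ p⁻ i ℤ.≟ ℤ.0ℤ) (λ nonzero → none (i , ℕ.s≤s i≤T , m≤i , nonzero)))
          (not-all-zero m)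

      infinitely-many : ∀ m → ∃[ n ] (m ℕ.≤ n × 1 ℕ.≤ n × Admissible n × countDistinct p⁻ (n ℕ.∸ 1) ≢ countDistinct p⁺ n)
      -- Starting at m + 1 excludes n = 0, where the excess is not a difference of two counts.
      infinitely-many m = convert (nonzero-excess (suc m))
        where
        convert : ∃[ n ] (suc m ℕ.≤ n × excess p⁺ p⁻ n ≢ ℤ.0ℤ) →
          ∃[ n ] (m ℕ.≤ n × 1 ℕ.≤ n × Admissible n × countDistinct p⁻ (n ℕ.∸ 1) ≢ countDistinct p⁺ n)
        convert (suc n , m<n , nonzero) = suc n , ℕₚ.<⇒≤ m<n , ℕ.s≤s ℕ.z≤n ,
          Sum.fromInj₁ (λ zero-excess → contradiction zero-excess nonzero) (excess-support (suc n)) ,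
          (λ eq → nonzero (≡.trans (≡.cong (λ z → + countDistinct p⁺ (suc n) ℤ.- + z) eq) (ℤₚ.+-inverseʳ (+ countDistinct p⁺ (suc n)))))

    equal-off-support : ∀ n → n % 6 ≡ 4 → countDistinct p⁻ (n ℕ.∸ 1) ≡ countDistinct p⁺ n
    equal-off-support (suc n) n%6≡4 = convert (excess-support (suc n))
      where
      convert : Admissible (suc n) ⊎ excess p⁺ p⁻ (suc n) ≡ ℤ.0ℤ → countDistinct p⁻ n ≡ countDistinct p⁺ (suc n)
      convert (inj₁ (inj₁ eq)) = contradiction (≡.trans (≡.sym n%6≡4) eq) (λ ())
      convert (inj₁ (inj₂ eq)) = contradiction (≡.trans (≡.sym n%6≡4) eq) (λ ())
      convert (inj₂ eq) = ≡.sym (ℤₚ.+-injective (ℤₚ.i-j≡0⇒i≡j _ _ eq))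

-- The moduli 24 and 30

-- (u - v)(u + v) = d forces u ≤ u + v ≤ d.
squares-apart : ∀ u v d → u ℕ.* u ≡ v ℕ.* v ℕ.+ suc d → u ℕ.≤ suc d
squares-apart u v d eq with ℕₚ.≤-<-connex u v
... | inj₁ u≤v = contradiction (ℕₚ.≤-trans (ℕₚ.≤-reflexive (≡.sym eq)) (ℕₚ.*-mono-≤ u≤v u≤v)) (ℕₚ.m+1+n≰m (v ℕ.* v))
... | inj₂ v<u = ℕₚ.+-cancelˡ-≤ (v ℕ.* v) u (suc d) (begin
  v ℕ.* v ℕ.+ u          ≤⟨ ℕₚ.+-monoˡ-≤ u (ℕₚ.*-monoʳ-≤ v (ℕₚ.<⇒≤ v<u)) ⟩
  v ℕ.* u ℕ.+ u          ≡⟨ ℕₚ.+-comm (v ℕ.* u) u ⟩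
  suc v ℕ.* u            ≤⟨ ℕₚ.*-monoˡ-≤ u v<u ⟩
  u ℕ.* u                ≡⟨ eq ⟩
  v ℕ.* v ℕ.+ suc d      ∎)
  where open ℕₚ.≤-Reasoning

i*i≡∣i∣*∣i∣ : ∀ i → i ℤ.* i ≡ + (∣ i ∣ ℕ.* ∣ i ∣)
i*i≡∣i∣*∣i∣ (+ n) = ≡.sym (ℤₚ.pos-* n n)
i*i≡∣i∣*∣i∣ -[1+ n ] = ≡.refl

expo₂-cong : ∀ a c b d k l → expo a c k ≡ expo b d l → expo₂ (+ a) (+ c) k ≡ expo₂ (+ b) (+ d) l
expo₂-cong a c b d k l eq = ≡.trans (≡.sym (expo-double a c k)) (≡.trans (≡.cong (λ e → + e ℤ.+ + e) eq) (expo-double b d l))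

-- For a common exponent e, 4e + 1 = (4k + 1)² and 4e + 4 = (12j + 2)² with j = m + 1. Squares at
-- distance 3 force 12j + 2 ≤ 3.
no-term₂₄ : ∀ m k → expo 6 2 k ≢ expo 48 24 (+ suc m)
no-term₂₄ m k eq = contradiction (squares-apart u ∣ v ∣ 2 (ℤₚ.+-injective squares)) (ℕₚ.<⇒≱ big)
  where
  v = + 4 ℤ.* k ℤ.+ + 1
  u = 12 ℕ.* suc m ℕ.+ 2
  big : 3 ℕ.< u
  big = ℕₚ.≤-trans (ℕₚ.m≤m+n 4 _) (ℕₚ.≤-trans (ℕₚ.*-monoʳ-≤ 12 (ℕ.s≤s (ℕ.z≤n {m}))) (ℕₚ.m≤m+n (12 ℕ.* suc m) 2))
  left : ∀ k → (+ 4 ℤ.* k ℤ.+ + 1) ℤ.* (+ 4 ℤ.* k ℤ.+ + 1) ℤ.+ + 3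
    ≡ (+ 6 ℤ.* (k ℤ.* k ℤ.+ k) ℤ.+ + 2 ℤ.* (k ℤ.* k ℤ.- k)) ℤ.* + 2 ℤ.+ + 4
  left = solve-∀
  right : ∀ j → (+ 48 ℤ.* (j ℤ.* j ℤ.+ j) ℤ.+ + 24 ℤ.* (j ℤ.* j ℤ.- j)) ℤ.* + 2 ℤ.+ + 4
    ≡ (+ 12 ℤ.* j ℤ.+ + 2) ℤ.* (+ 12 ℤ.* j ℤ.+ + 2)
  right = solve-∀
  squares : + (u ℕ.* u) ≡ + (∣ v ∣ ℕ.* ∣ v ∣ ℕ.+ 3)
  squares = ≡.sym (begin
    + (∣ v ∣ ℕ.* ∣ v ∣) ℤ.+ + 3                      ≡⟨ ≡.cong (ℤ._+ + 3) (i*i≡∣i∣*∣i∣ v) ⟨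
    v ℤ.* v ℤ.+ + 3                                 ≡⟨ left k ⟩
    expo₂ (+ 6) (+ 2) k ℤ.* + 2 ℤ.+ + 4             ≡⟨ ≡.cong (λ z → z ℤ.* + 2 ℤ.+ + 4) (expo₂-cong 6 2 48 24 k (+ suc m) eq) ⟩
    expo₂ (+ 48) (+ 24) (+ suc m) ℤ.* + 2 ℤ.+ + 4   ≡⟨ right (+ suc m) ⟩
    + u ℤ.* + u                                     ≡⟨ ℤₚ.pos-* u u ⟨
    + (u ℕ.* u)                                     ∎)
    where open ≡.≡-Reasoning

-- For a common exponent e, 20e + 9 = (10k + 3)² and 20e + 25 = (30j + 5)² with j = m + 1. Squares
-- at distance 16 force 30j + 5 ≤ 16.
no-term₃₀ : ∀ m k → expo 8 2 k ≢ expo 60 30 (+ suc m)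
no-term₃₀ m k eq = contradiction (squares-apart u ∣ v ∣ 15 (ℤₚ.+-injective squares)) (ℕₚ.<⇒≱ big)
  where
  v = + 10 ℤ.* k ℤ.+ + 3
  u = 30 ℕ.* suc m ℕ.+ 5
  big : 16 ℕ.< u
  big = ℕₚ.≤-trans (ℕₚ.m≤m+n 17 _) (ℕₚ.≤-trans (ℕₚ.*-monoʳ-≤ 30 (ℕ.s≤s (ℕ.z≤n {m}))) (ℕₚ.m≤m+n (30 ℕ.* suc m) 5))
  left : ∀ k → (+ 10 ℤ.* k ℤ.+ + 3) ℤ.* (+ 10 ℤ.* k ℤ.+ + 3) ℤ.+ + 16
    ≡ (+ 8 ℤ.* (k ℤ.* k ℤ.+ k) ℤ.+ + 2 ℤ.* (k ℤ.* k ℤ.- k)) ℤ.* + 10 ℤ.+ + 25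
  left = solve-∀
  right : ∀ j → (+ 60 ℤ.* (j ℤ.* j ℤ.+ j) ℤ.+ + 30 ℤ.* (j ℤ.* j ℤ.- j)) ℤ.* + 10 ℤ.+ + 25
    ≡ (+ 30 ℤ.* j ℤ.+ + 5) ℤ.* (+ 30 ℤ.* j ℤ.+ + 5)
  right = solve-∀
  squares : + (u ℕ.* u) ≡ + (∣ v ∣ ℕ.* ∣ v ∣ ℕ.+ 16)
  squares = ≡.sym (begin
    + (∣ v ∣ ℕ.* ∣ v ∣) ℤ.+ + 16                      ≡⟨ ≡.cong (ℤ._+ + 16) (i*i≡∣i∣*∣i∣ v) ⟨
    v ℤ.* v ℤ.+ + 16                                 ≡⟨ left k ⟩
    expo₂ (+ 8) (+ 2) k ℤ.* + 10 ℤ.+ + 25            ≡⟨ ≡.cong (λ z → z ℤ.* + 10 ℤ.+ + 25) (expo₂-cong 8 2 60 30 k (+ suc m) eq) ⟩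
    expo₂ (+ 60) (+ 30) (+ suc m) ℤ.* + 10 ℤ.+ + 25  ≡⟨ right (+ suc m) ⟩
    + u ℤ.* + u                                      ≡⟨ ℤₚ.pos-* u u ⟨
    + (u ℕ.* u)                                      ∎)
    where open ≡.≡-Reasoning

private
  admissible-2tri : ∀ n → Admissible (2 ℕ.* tri n)
  admissible-2tri 0 = inj₁ ≡.refl
  admissible-2tri 1 = inj₂ ≡.refl
  admissible-2tri 2 = inj₁ ≡.refl
  admissible-2tri (suc (suc (suc n))) = ≡.subst Admissible (identity (tri n) n) (admissible-+6 (n ℕ.+ 2) (2 ℕ.* tri n) (admissible-2tri n))
    where
    identity : ∀ t n → 2 ℕ.* t ℕ.+ (n ℕ.+ 2) ℕ.* 6 ≡ 2 ℕ.* ((3 ℕ.+ n) ℕ.+ ((2 ℕ.+ n) ℕ.+ ((1 ℕ.+ n) ℕ.+ t)))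
    identity = ℕSolver.solve-∀

  admissible-2tri⁻ : ∀ k → Admissible (2 ℕ.* tri⁻ k)
  admissible-2tri⁻ (+ zero) = inj₁ ≡.refl
  admissible-2tri⁻ (+ suc n) = admissible-2tri n
  admissible-2tri⁻ -[1+ n ] = admissible-2tri (suc n)

  admissible-2n² : ∀ n → Admissible (2 ℕ.* (n ℕ.* n))
  admissible-2n² 0 = inj₁ ≡.refl
  admissible-2n² 1 = inj₂ ≡.refl
  admissible-2n² 2 = inj₂ ≡.refl
  admissible-2n² (suc (suc (suc n))) = ≡.subst Admissible (identity n) (admissible-+6 (2 ℕ.* n ℕ.+ 3) (2 ℕ.* (n ℕ.* n)) (admissible-2n² n))
    where
    identity : ∀ n → 2 ℕ.* (n ℕ.* n) ℕ.+ (2 ℕ.* n ℕ.+ 3) ℕ.* 6 ≡ 2 ℕ.* ((3 ℕ.+ n) ℕ.* (3 ℕ.+ n))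
    identity = ℕSolver.solve-∀

  tri-square : ∀ n → tri (suc n) ℕ.+ tri n ≡ suc n ℕ.* suc n
  tri-square zero = ≡.refl
  tri-square (suc n) = ≡.trans (regroup (tri (suc n)) (tri n) n) (≡.trans (≡.cong (λ z → (2 ℕ.+ n) ℕ.+ (1 ℕ.+ n) ℕ.+ z) (tri-square n)) (identity n))
    where
    regroup : ∀ s t n → (2 ℕ.+ n) ℕ.+ s ℕ.+ ((1 ℕ.+ n) ℕ.+ t) ≡ (2 ℕ.+ n) ℕ.+ (1 ℕ.+ n) ℕ.+ (s ℕ.+ t)
    regroup = ℕSolver.solve-∀
    identity : ∀ n → (2 ℕ.+ n) ℕ.+ (1 ℕ.+ n) ℕ.+ (1 ℕ.+ n) ℕ.* (1 ℕ.+ n) ≡ (2 ℕ.+ n) ℕ.* (2 ℕ.+ n)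
    identity = ℕSolver.solve-∀

  tri⁺+tri⁻ : ∀ k → tri⁺ k ℕ.+ tri⁻ k ≡ ∣ k ∣ ℕ.* ∣ k ∣
  tri⁺+tri⁻ (+ zero) = ≡.refl
  tri⁺+tri⁻ (+ suc n) = tri-square n
  tri⁺+tri⁻ -[1+ n ] = ≡.trans (ℕₚ.+-comm (tri n) (tri (suc n))) (tri-square n)

opaque
  unfolding expo

  -- Modulo 6 only twice a triangular number remains, and triangular numbers are 0 or 1 modulo 3.
  admissible-expo₂₄ : ∀ k → Admissible (expo 6 2 k)
  admissible-expo₂₄ k = ≡.subst Admissible (identity (tri⁺ k) (tri⁻ k)) (admissible-+6 (tri⁺ k) (2 ℕ.* tri⁻ k) (admissible-2tri⁻ k))
    where
    identity : ∀ x y → 2 ℕ.* y ℕ.+ x ℕ.* 6 ≡ 6 ℕ.* x ℕ.+ 2 ℕ.* y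
    identity = ℕSolver.solve-∀

  -- Here 8x + 2y = 6x + 2(x + y) with x + y = k², and squares are 0 or 1 modulo 3.
  admissible-expo₃₀ : ∀ k → Admissible (expo 8 2 k)
  admissible-expo₃₀ k = ≡.subst Admissible
    (≡.trans (≡.cong (λ z → 2 ℕ.* z ℕ.+ tri⁺ k ℕ.* 6) (≡.sym (tri⁺+tri⁻ k))) (identity (tri⁺ k) (tri⁻ k)))
    (admissible-+6 (tri⁺ k) (2 ℕ.* (∣ k ∣ ℕ.* ∣ k ∣)) (admissible-2n² ∣ k ∣))
    where
    identity : ∀ x y → 2 ℕ.* (x ℕ.+ y) ℕ.+ x ℕ.* 6 ≡ 8 ℕ.* x ℕ.+ 2 ℕ.* y
    identity = ℕSolver.solve-∀

-- Products over one period

r₅ r₁₁ r₇ r₁₃ : List ℕ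
r₅ = 1 ∷ 23 ∷ 5 ∷ 19 ∷ 7 ∷ 17 ∷ 9 ∷ 15 ∷ []
r₁₁ = 1 ∷ 23 ∷ 7 ∷ 17 ∷ 9 ∷ 15 ∷ 11 ∷ 13 ∷ []
r₇ = 1 ∷ 29 ∷ 7 ∷ 23 ∷ 9 ∷ 21 ∷ 11 ∷ 19 ∷ []
r₁₃ = 1 ∷ 29 ∷ 9 ∷ 21 ∷ 11 ∷ 19 ∷ 13 ∷ 17 ∷ []

res24-periodic : ∀ rs k i → res24 rs (k ℕ.+ i ℕ.* 24) ≡ res24 rs k
res24-periodic rs k i = ≡.cong (λ m → any (λ r → ⌊ m ℕ.≟ r ⌋) rs) ([m+kn]%n≡m%n k i 24)

res30-periodic : ∀ rs k i → res30 rs (k ℕ.+ i ℕ.* 30) ≡ res30 rs k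
res30-periodic rs k i = ≡.cong (λ m → any (λ r → ⌊ m ℕ.≟ r ⌋) rs) ([m+kn]%n≡m%n k i 30)

module Blocks {c ℓ} (R : CommutativeRing c ℓ) (q : CommutativeRing.Carrier R) where

  open CommutativeRing R hiding (zero)
  open Sums R
  open Nilpotent R q
  open Quintuple R q using (block⁺; block⁻)
  open SemiringSolver commutativeSemiring using (solve; _:=_; _:*_; con)

  private
    period : ∀ (p : ℕ → Bool) d → (∀ k i → p (k ℕ.+ i ℕ.* d) ≡ p k) → ∀ i →
      prod d (λ j → part p (suc (j ℕ.+ i ℕ.* d))) ≈ prod d (λ j → if p (suc j) then factor 1# (suc j ℕ.+ d ℕ.* i) else 1#)
    period p d periodic i = prod-cong d (λ j → reflexive
      (≡.cong₂ (λ b e → if b then factor 1# e else 1#) (periodic (suc j) i) (≡.cong (suc j ℕ.+_) (ℕₚ.*-comm i d))))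

  -- The identity given to the solver spells out one period: the empty product, then the residues in
  -- order, with a variable at each allowed residue and `con 1` elsewhere.
  split₅ : ∀ i → prod 24 (λ j → part (res24 r₅) (suc (j ℕ.+ i ℕ.* 24))) ≈ block⁻ 2 i
  split₅ i = trans (period (res24 r₅) 24 (res24-periodic r₅) i)
    (solve 8 (λ x₁ x₂ x₃ x₄ x₅ x₆ x₇ x₈ →
        con 1 :* x₁ :* con 1 :* con 1 :* con 1 :* x₂ :* con 1 :* x₃ :* con 1 :* x₄ :* con 1 :* con 1
          :* con 1 :* con 1 :* con 1 :* x₅ :* con 1 :* x₆ :* con 1 :* x₇ :* con 1 :* con 1 :* con 1 :* x₈ :* con 1
        := x₁ :* x₂ :* x₃ :* x₄ :* x₅ :* x₆ :* x₇ :* x₈) refl _ _ _ _ _ _ _ _)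

  split₁₁ : ∀ i → prod 24 (λ j → part (res24 r₁₁) (suc (j ℕ.+ i ℕ.* 24))) ≈ block⁺ 2 i
  split₁₁ i = trans (period (res24 r₁₁) 24 (res24-periodic r₁₁) i)
    (solve 8 (λ x₁ x₂ x₃ x₄ x₅ x₆ x₇ x₈ →
        con 1 :* x₁ :* con 1 :* con 1 :* con 1 :* con 1 :* con 1 :* x₂ :* con 1 :* x₃ :* con 1 :* x₄
          :* con 1 :* x₅ :* con 1 :* x₆ :* con 1 :* x₇ :* con 1 :* con 1 :* con 1 :* con 1 :* con 1 :* x₈ :* con 1
        := x₁ :* x₂ :* x₃ :* x₄ :* x₅ :* x₆ :* x₇ :* x₈) refl _ _ _ _ _ _ _ _)

  split₇ : ∀ i → prod 30 (λ j → part (res30 r₇) (suc (j ℕ.+ i ℕ.* 30))) ≈ block⁻ 3 i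
  split₇ i = trans (period (res30 r₇) 30 (res30-periodic r₇) i)
    (solve 8 (λ x₁ x₂ x₃ x₄ x₅ x₆ x₇ x₈ →
        con 1 :* x₁ :* con 1 :* con 1 :* con 1 :* con 1 :* con 1 :* x₂ :* con 1 :* x₃ :* con 1 :* x₄ :* con 1 :* con 1 :* con 1
          :* con 1 :* con 1 :* con 1 :* con 1 :* x₅ :* con 1 :* x₆ :* con 1 :* x₇ :* con 1 :* con 1 :* con 1 :* con 1 :* con 1 :* x₈ :* con 1
        := x₁ :* x₂ :* x₃ :* x₄ :* x₅ :* x₆ :* x₇ :* x₈) refl _ _ _ _ _ _ _ _)

  split₁₃ : ∀ i → prod 30 (λ j → part (res30 r₁₃) (suc (j ℕ.+ i ℕ.* 30))) ≈ block⁺ 3 i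
  split₁₃ i = trans (period (res30 r₁₃) 30 (res30-periodic r₁₃) i)
    (solve 8 (λ x₁ x₂ x₃ x₄ x₅ x₆ x₇ x₈ →
        con 1 :* x₁ :* con 1 :* con 1 :* con 1 :* con 1 :* con 1 :* con 1 :* con 1 :* x₂ :* con 1 :* x₃ :* con 1 :* x₄ :* con 1
          :* con 1 :* con 1 :* x₅ :* con 1 :* x₆ :* con 1 :* x₇ :* con 1 :* con 1 :* con 1 :* con 1 :* con 1 :* con 1 :* con 1 :* x₈ :* con 1
        := x₁ :* x₂ :* x₃ :* x₄ :* x₅ :* x₆ :* x₇ :* x₈) refl _ _ _ _ _ _ _ _)

-- As M = μ + 2, these are M = 4 and M = 5; G counts for `Q11` and `𝔔13`, F for `Q5` and `𝔔7`.
module Mod24 = Pair 2 (res24 r₁₁) (res24 r₅) Blocks.split₁₁ Blocks.split₅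
module Mod30 = Pair 3 (res30 r₁₃) (res30 r₇) Blocks.split₁₃ Blocks.split₇

theorem1p1 : ((n : ℕ) → n % 6 ≡ 4 → (Q5 (n ∸ 1) ≡ Q11 n) × (𝔔7 (n ∸ 1) ≡ 𝔔13 n))
    × ((N : ℕ) → ∃[ n ] (N ≤ n × 1 ≤ n × (n % 6 ≡ 0 ⊎ n % 6 ≡ 2) × Q5 (n ∸ 1) ≢ Q11 n))
    × ((N : ℕ) → ∃[ m ] (N ≤ m × 1 ≤ m × (m % 6 ≡ 0 ⊎ m % 6 ≡ 2) × 𝔔7 (m ∸ 1) ≢ 𝔔13 m))
theorem1p1 =
  (λ n n%6≡4 → Mod24.equal-off-support admissible-expo₂₄ n n%6≡4 , Mod30.equal-off-support admissible-expo₃₀ n n%6≡4) ,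
  Mod24.infinitely-many admissible-expo₂₄ no-term₂₄ ,
  Mod30.infinitely-many admissible-expo₃₀ no-term₃₀
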